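{- For a discretely ordered abelian group $(G,<)$, the following are equivalent: a) $(G,<)$ is symmetrically d-complete, b) $(G,<)$ is spherically complete w.r.t. the order balls, c) $(G,<)$ is a $\mathbb{Z}$-group such that $G/\mathbb{Z}$ is strongly symmetrically complete. Further, $(G,<)$ is extremely symmetrically d-complete if and only if $G/\mathbb{Z}$ is extremely symmetrically complete.
   Context: Ordered means linearly ordered. An ordered abelian group is discretely ordered if it has a smallest positive element; the convex subgroup generated by this element is isomorphic to $\mathbb{Z}$ and is identified with $\mathbb{Z}$, and $G/\mathbb{Z}$ carries the induced ordering. $G$ is a $\mathbb{Z}$-group if it admits (an isomorphic image of) $\mathbb{Z}$ as a convex subgroup such that $G/\mathbb{Z}$ is divisible. A linearly ordered set is spherically complete w.r.t. the order balls if every nonempty chain (w.r.t. inclusion) of closed bounded intervals $[a,b]$, $a\le b$, has nonempty intersection. A cut in a linearly ordered set $I$ is a pair $(D,E)$ of nonempty subsets with $I=D\cup E$ and $d<e$ for all $d\in D$, $e\in E$. Its cofinality is $(\kappa,\lambda)$ with $\kappa=\mathrm{cf}(D)$ the cofinality of $D$ and $\lambda=\mathrm{ci}(E)$ the coinitiality of $E$ (cofinality under the reversed ordering); these equal $1$ when $D$ has a maximum, resp. $E$ has a minimum. The cut is principal if $D$ has a maximum or $E$ has a minimum; asymmetric if $\kappa\ne\lambda$; strongly asymmetric if $\kappa\ne\lambda$ and at least one of $\kappa,\lambda$ is uncountable. $I$ is strongly symmetrically complete if every cut in $I$ is strongly asymmetric, and extremely symmetrically complete if in addition both its coinitiality and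 cofinality are uncountable. An ordered abelian group $G$ is symmetrically d-complete if every nonprincipal cut in $G$ is asymmetric, and extremely symmetrically d-complete if in addition $G$ has uncountable cofinality. All these notions for ordered abelian groups refer to the underlying linearly ordered set. -}

module Defs where

open import Level using (Level; suc)
open import Algebra.Bundles using (AbelianGroup)
open import Algebra.Structures using (IsAbelianGroup)
open import Algebra.Morphism.Structures using (IsGroupHomomorphism)
import Algebra.Definitions.RawMonoid as RawMonoidMult
import Algebra.Properties.AbelianGroup as AbelianGroupProperties
import Algebra.Properties.Monoid.Mult as MultProperties
import Algebra.Properties.CommutativeSemigroup as CommutativeSemigroupProperties
open import Data.Integer.Base as ℤ using (ℤ)
import Data.Integer.Properties as ℤ
open import Data.Nat.Base as ℕ using (ℕ; zero; NonZero)
open import Data.Product.Base using (Σ; Σ-syntax; ∃; ∃-syntax; _×_; _,_; proj₁; proj₂)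
open import Data.Sum.Base using (_⊎_; inj₁; inj₂)
open import Function.Bundles using (Injection; Inverse; _⇔_)
open import Relation.Binary.Bundles using (Setoid; TotalOrder)
open import Relation.Binary.Core using (Rel)
open import Relation.Binary.Definitions using (Maximum; Minimum; _Respects_)
open import Relation.Binary.Structures using (IsTotalOrder)
open import Relation.Binary.Morphism.Structures using (IsOrderMonomorphism)
import Relation.Binary.Construct.Flip.EqAndOrd as Flip
import Relation.Binary.Construct.NonStrictToStrict as ToStrict
import Relation.Binary.Construct.On as On
import Relation.Binary.Reasoning.PartialOrder as ≤-Reasoning
open import Relation.Binary.PropositionalEquality.Core using (_≡_)
open import Relation.Binary.PropositionalEquality.Properties using (setoid)
open import Relation.Nullary.Negation.Core using (¬_)
open import Relation.Unary using (Pred; Satisfiable; _⊆_)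

private
  variable
    ℓ : Level

------------------------------------------------------------------------
-- Cardinality, cofinality and cuts

-- A "set" is a setoid whose carrier and equality live in one universe
-- Set ℓ.  A linearly ordered set is a total order in the same sense, and
-- its subsets are the predicates Pred Carrier ℓ.

LinearOrder : ∀ ℓ → Set (suc ℓ)
LinearOrder ℓ = TotalOrder ℓ ℓ ℓ

-- Cardinals are represented by sets, and compared through bijections
-- and injections.

Uncountable : Setoid ℓ ℓ → Set ℓ
Uncountable κ = ¬ Injection κ (setoid ℕ)

module _ (I : LinearOrder ℓ) where
  open TotalOrder I

  infix 4 _<ᴵ_
  _<ᴵ_ : Rel Carrier ℓ
  _<ᴵ_ = ToStrict._<_ _≈_ _≤_

  restrict : Pred Carrier ℓ → LinearOrder ℓ
  restrict S = On.totalOrder {B = Σ Carrier S} I proj₁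

  Cofinal : Pred Carrier ℓ → Set ℓ
  Cofinal S = ∀ x → ∃[ y ] S y × x ≤ y

subsetSetoid : (I : LinearOrder ℓ) → Pred (TotalOrder.Carrier I) ℓ → Setoid ℓ ℓ
subsetSetoid I S = TotalOrder.Eq.setoid (restrict I S)

-- κ is the smallest cardinality of a cofinal subset of I.
record IsCofinality (I : LinearOrder ℓ) (κ : Setoid ℓ ℓ) : Set (suc ℓ) where
  field
    subset       : Pred (TotalOrder.Carrier I) ℓ
    cofinal      : Cofinal I subset
    equinumerous : Inverse κ (subsetSetoid I subset)
    minimal      : ∀ S → Cofinal I S → Injection κ (subsetSetoid I S)

IsCoinitiality : LinearOrder ℓ → Setoid ℓ ℓ → Set (suc ℓ)
IsCoinitiality I = IsCofinality (Flip.totalOrder I)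

UncountableCofinality : LinearOrder ℓ → Set (suc ℓ)
UncountableCofinality {ℓ} I = Σ[ κ ∈ Setoid ℓ ℓ ] IsCofinality I κ × Uncountable κ

UncountableCoinitiality : LinearOrder ℓ → Set (suc ℓ)
UncountableCoinitiality I = UncountableCofinality (Flip.totalOrder I)

record Cut (I : LinearOrder ℓ) : Set (suc ℓ) where
  open TotalOrder I using (Carrier)
  field
    D E        : Pred Carrier ℓ
    D-nonempty : Satisfiable D
    E-nonempty : Satisfiable E
    cover      : ∀ x → D x ⊎ E x
    D<E        : ∀ {d e} → D d → E e → _<ᴵ_ I d e

module _ {I : LinearOrder ℓ} (C : Cut I) where
  open Cut C

  HasCofinality : Setoid ℓ ℓ → Setoid ℓ ℓ → Set (suc ℓ)
  HasCofinality κ λ′ = IsCofinality (restrict I D) κ × IsCoinitiality (restrict I E) λ′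

  Principal : Set ℓ
  Principal = ∃ (Maximum (TotalOrder._≤_ (restrict I D)))
            ⊎ ∃ (Minimum (TotalOrder._≤_ (restrict I E)))

  Asymmetric : Set (suc ℓ)
  Asymmetric = ∃[ κ ] ∃[ λ′ ] HasCofinality κ λ′ × ¬ Inverse κ λ′

  StronglyAsymmetric : Set (suc ℓ)
  StronglyAsymmetric = ∃[ κ ] ∃[ λ′ ] HasCofinality κ λ′ × ¬ Inverse κ λ′
                         × (Uncountable κ ⊎ Uncountable λ′)

------------------------------------------------------------------------
-- Completeness notions for linearly ordered sets

module _ (I : LinearOrder ℓ) where
  open TotalOrder I

  SymmetricallyDComplete : Set (suc ℓ)
  SymmetricallyDComplete = (C : Cut I) → ¬ Principal C → Asymmetric C

  ExtremelySymmetricallyDComplete : Set (suc ℓ)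
  ExtremelySymmetricallyDComplete = SymmetricallyDComplete × UncountableCofinality I

  StronglySymmetricallyComplete : Set (suc ℓ)
  StronglySymmetricallyComplete = (C : Cut I) → StronglyAsymmetric C

  ExtremelySymmetricallyComplete : Set (suc ℓ)
  ExtremelySymmetricallyComplete =
    StronglySymmetricallyComplete × UncountableCoinitiality I × UncountableCofinality I

  record ClosedInterval : Set ℓ where
    field
      lower upper : Carrier
      lower≤upper : lower ≤ upper

  points : ClosedInterval → Pred Carrier ℓ
  points J x = lower ≤ x × x ≤ upper
    where open ClosedInterval J

  IsChain : Pred ClosedInterval ℓ → Set ℓ
  IsChain 𝓑 = ∀ {J K} → 𝓑 J → 𝓑 K → points J ⊆ points K ⊎ points K ⊆ points J

  SphericallyComplete : Set (suc ℓ)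
  SphericallyComplete = (𝓑 : Pred ClosedInterval ℓ) → Satisfiable 𝓑 → IsChain 𝓑 →
                        ∃[ x ] (∀ {J} → 𝓑 J → points J x)

------------------------------------------------------------------------
-- Ordered abelian groups

record OrderedAbelianGroup ℓ : Set (suc ℓ) where
  infix  8 -_
  infixl 6 _+_
  infix  4 _≈_ _≤_
  field
    Carrier        : Set ℓ
    _≈_ _≤_        : Rel Carrier ℓ
    _+_            : Carrier → Carrier → Carrier
    0#             : Carrier
    -_             : Carrier → Carrier
    isAbelianGroup : IsAbelianGroup _≈_ _+_ 0# -_
    isTotalOrder   : IsTotalOrder _≈_ _≤_
    +-monoˡ-≤      : ∀ {x y} z → x ≤ y → x + z ≤ y + z

  abelianGroup : AbelianGroup ℓ ℓ
  abelianGroup = record { isAbelianGroup = isAbelianGroup }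

  totalOrder : LinearOrder ℓ
  totalOrder = record { isTotalOrder = isTotalOrder }

  open AbelianGroup abelianGroup public
    using (setoid; rawGroup; rawMonoid; monoid; refl; sym; trans)
    renaming ( ∙-cong to +-cong; ∙-congˡ to +-congˡ; ∙-congʳ to +-congʳ
             ; assoc to +-assoc; comm to +-comm
             ; identityˡ to +-identityˡ; identityʳ to +-identityʳ
             ; inverseˡ to -‿inverseˡ; inverseʳ to -‿inverseʳ
             ; ⁻¹-cong to -‿cong )

  open RawMonoidMult rawMonoid public using () renaming (_×_ to _·_)

  infix 4 _<_
  _<_ : Rel Carrier ℓ
  _<_ = _<ᴵ_ totalOrder

  infixl 6 _-_
  _-_ : Carrier → Carrier → Carrier
  x - y = x + (- y)

module _ (G : OrderedAbelianGroup ℓ) where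
  open OrderedAbelianGroup G

  Divisible : Set ℓ
  Divisible = ∀ n → .{{NonZero n}} → ∀ x → ∃[ y ] n · y ≈ x

  record IsLeastPositive (e : Carrier) : Set ℓ where
    field
      positive : 0# < e
      least    : ∀ {x} → 0# < x → e ≤ x

  record ConvexSubgroup : Set (suc ℓ) where
    field
      Member    : Pred Carrier ℓ
      resp      : Member Respects _≈_
      +-closed  : ∀ {x y} → Member x → Member y → Member (x + y)
      0#-member : Member 0#
      -‿closed  : ∀ {x} → Member x → Member (- x)
      convex    : ∀ {x y z} → Member x → Member z → x ≤ y → y ≤ z → Member y

module OrderedGroupLemmas (G : OrderedAbelianGroup ℓ) where
  open OrderedAbelianGroup G public
  open AbelianGroup abelianGroup using (commutativeSemigroup)
  open AbelianGroupProperties abelianGroup public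
    using ()
    renaming ( ⁻¹-∙-comm to -‿+-comm; ⁻¹-involutive to -‿involutive
             ; ε⁻¹≈ε to -0#≈0# )
  open CommutativeSemigroupProperties commutativeSemigroup public
    using (interchange; xy∙z≈xz∙y)
  open MultProperties monoid public using (×-homo-+)
  open TotalOrder totalOrder public
    using (poset; total; antisym)
    renaming (trans to ≤-trans; reflexive to ≤-reflexive; refl to ≤-refl)

  private module R = ≤-Reasoning poset

  +-mono-≤ : ∀ {x y u v} → x ≤ y → u ≤ v → x + u ≤ y + v
  +-mono-≤ {x} {y} {u} {v} x≤y u≤v = begin
    x + u ≤⟨ +-monoˡ-≤ u x≤y ⟩
    y + u ≈⟨ +-comm y u ⟩
    u + y ≤⟨ +-monoˡ-≤ y u≤v ⟩
    v + y ≈⟨ +-comm v y ⟩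
    y + v ∎
    where open R

  x+y-y : ∀ x y → (x + y) - y ≈ x
  x+y-y x y = trans (+-assoc x y (- y)) (trans (+-congˡ (-‿inverseʳ y)) (+-identityʳ x))

  x-y+y : ∀ x y → (x - y) + y ≈ x
  x-y+y x y = trans (+-assoc x (- y) y) (trans (+-congˡ (-‿inverseˡ y)) (+-identityʳ x))

  -‿flip : ∀ x y → - (x - y) ≈ y - x
  -‿flip x y = trans (sym (-‿+-comm x (- y)))
              (trans (+-congˡ (-‿involutive y)) (+-comm (- x) y))

  -‿anti-≤ : ∀ {x y} → x ≤ y → - y ≤ - x
  -‿anti-≤ {x} {y} x≤y = begin
    - y             ≈⟨ x+y-y (- y) x ⟨
    (- y + x) - x   ≈⟨ +-congʳ (+-comm (- y) x) ⟩
    (x - y) - x     ≤⟨ +-monoˡ-≤ (- x) (+-monoˡ-≤ (- y) x≤y) ⟩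
    (y - y) - x     ≈⟨ +-congʳ (-‿inverseʳ y) ⟩
    0# - x          ≈⟨ +-identityˡ (- x) ⟩
    - x             ∎
    where open R

  -- If x ≤ y + h then x - y ≤ h.
  ≤+⇒-≤ : ∀ {x y h} → x ≤ y + h → x - y ≤ h
  ≤+⇒-≤ {x} {y} {h} x≤y+h = begin
    x - y       ≤⟨ +-monoˡ-≤ (- y) x≤y+h ⟩
    (y + h) - y ≈⟨ +-congʳ (+-comm y h) ⟩
    (h + y) - y ≈⟨ x+y-y h y ⟩
    h           ∎
    where open R

  ·-nonneg : ∀ {e} → 0# ≤ e → ∀ n → 0# ≤ n · e
  ·-nonneg 0≤e zero        = ≤-refl
  ·-nonneg 0≤e (ℕ.suc n)   =
    ≤-trans (≤-reflexive (sym (+-identityˡ 0#))) (+-mono-≤ 0≤e (·-nonneg 0≤e n))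

  ·-monoʳ : ∀ {e} → 0# ≤ e → ∀ m n → m · e ≤ (m ℕ.+ n) · e
  ·-monoʳ {e} 0≤e m n = begin
    m · e           ≈⟨ +-identityʳ (m · e) ⟨
    m · e + 0#      ≤⟨ +-mono-≤ ≤-refl (·-nonneg 0≤e n) ⟩
    m · e + n · e   ≈⟨ ×-homo-+ e m n ⟨
    (m ℕ.+ n) · e   ∎
    where open R

  ·-monoˡ : ∀ {e} → 0# ≤ e → ∀ m n → n · e ≤ (m ℕ.+ n) · e
  ·-monoˡ {e} 0≤e m n = begin
    n · e           ≈⟨ +-identityˡ (n · e) ⟨
    0# + n · e      ≤⟨ +-mono-≤ (·-nonneg 0≤e m) ≤-refl ⟩
    m · e + n · e   ≈⟨ ×-homo-+ e m n ⟨
    (m ℕ.+ n) · e   ∎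
    where open R

-- The convex subgroup generated by a nonnegative element e, given as the
-- convex hull of the integer multiples of e.
module _ (G : OrderedAbelianGroup ℓ) where
  open OrderedGroupLemmas G

  generated : (e : Carrier) → 0# ≤ e → ConvexSubgroup G
  generated e 0≤e = record
    { Member    = λ x → ∃[ n ] - (n · e) ≤ x × x ≤ n · e
    ; resp      = λ x≈y (n , l , u) →
        n , ≤-trans l (≤-reflexive x≈y) , ≤-trans (≤-reflexive (sym x≈y)) u
    ; +-closed  = λ (m , l , u) (n , l′ , u′) →
        m ℕ.+ n
        , ≤-trans (≤-reflexive (trans (-‿cong (×-homo-+ e m n)) (sym (-‿+-comm (m · e) (n · e)))))
                  (+-mono-≤ l l′)
        , ≤-trans (+-mono-≤ u u′) (≤-reflexive (sym (×-homo-+ e m n)))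
    ; 0#-member = 0 , ≤-reflexive -0#≈0# , ≤-refl
    ; -‿closed  = λ {x} (n , l , u) →
        n , -‿anti-≤ u , ≤-trans (-‿anti-≤ l) (≤-reflexive (-‿involutive (n · e)))
    ; convex    = λ (m , l , _) (n , _ , u) x≤y y≤z →
        m ℕ.+ n
        , ≤-trans (-‿anti-≤ (·-monoʳ 0≤e m n)) (≤-trans l x≤y)
        , ≤-trans y≤z (≤-trans u (·-monoˡ 0≤e m n))
    }

-- The quotient G / H has the carrier of G, with congruence modulo H as
-- its equality; x + H ≤ y + H means that x lies below some element of
-- the coset y + H.
module _ (G : OrderedAbelianGroup ℓ) (H : ConvexSubgroup G) where
  open OrderedGroupLemmas G
  open ConvexSubgroup H

  infix 4 _≈ᴴ_ _≤ᴴ_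
  _≈ᴴ_ _≤ᴴ_ : Rel Carrier ℓ
  x ≈ᴴ y = Member (x - y)
  x ≤ᴴ y = ∃[ h ] Member h × x ≤ y + h

  private
    module R = ≤-Reasoning poset

    ≈⇒≈ᴴ : ∀ {x y} → x ≈ y → x ≈ᴴ y
    ≈⇒≈ᴴ {x} {y} x≈y = resp (sym (trans (+-congʳ x≈y) (-‿inverseʳ y))) 0#-member

    ≈ᴴ-trans : ∀ {x y z} → x ≈ᴴ y → y ≈ᴴ z → x ≈ᴴ z
    ≈ᴴ-trans {x} {y} {z} p q =
      resp (trans (sym (+-assoc (x - y) y (- z))) (+-congʳ (x-y+y x y))) (+-closed p q)

    ≈ᴴ-sym : ∀ {x y} → x ≈ᴴ y → y ≈ᴴ x
    ≈ᴴ-sym {x} {y} p = resp (-‿flip x y) (-‿closed p)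

    +-congᴴ : ∀ {x y u v} → x ≈ᴴ y → u ≈ᴴ v → x + u ≈ᴴ y + v
    +-congᴴ {x} {y} {u} {v} p q =
      resp (trans (interchange x (- y) u (- v)) (+-congˡ (-‿+-comm y v))) (+-closed p q)

    -‿congᴴ : ∀ {x y} → x ≈ᴴ y → - x ≈ᴴ - y
    -‿congᴴ {x} {y} p = resp (sym (-‿+-comm x (- y))) (-‿closed p)

    ≤⇒≤ᴴ : ∀ {x y} → x ≤ y → x ≤ᴴ y
    ≤⇒≤ᴴ {x} {y} x≤y = 0# , 0#-member , ≤-trans x≤y (≤-reflexive (sym (+-identityʳ y)))

    ≤ᴴ-reflexive : ∀ {x y} → x ≈ᴴ y → x ≤ᴴ y
    ≤ᴴ-reflexive {x} {y} p =
      x - y , p , ≤-reflexive (trans (sym (x-y+y x y)) (+-comm (x - y) y))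

    ≤ᴴ-trans : ∀ {x y z} → x ≤ᴴ y → y ≤ᴴ z → x ≤ᴴ z
    ≤ᴴ-trans {x} {y} {z} (h , h∈ , x≤) (k , k∈ , y≤) =
      k + h , +-closed k∈ h∈ ,
      ≤-trans x≤ (≤-trans (+-monoˡ-≤ h y≤) (≤-reflexive (+-assoc z k h)))

    ≤ᴴ-antisym : ∀ {x y} → x ≤ᴴ y → y ≤ᴴ x → x ≈ᴴ y
    ≤ᴴ-antisym {x} {y} (h , h∈ , x≤) (k , k∈ , y≤) =
      convex (-‿closed k∈) h∈
        (≤-trans (-‿anti-≤ (≤+⇒-≤ y≤)) (≤-reflexive (-‿flip y x)))
        (≤+⇒-≤ x≤)

    ≤ᴴ-total : ∀ x y → x ≤ᴴ y ⊎ y ≤ᴴ x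
    ≤ᴴ-total x y with total x y
    ... | inj₁ x≤y = inj₁ (≤⇒≤ᴴ x≤y)
    ... | inj₂ y≤x = inj₂ (≤⇒≤ᴴ y≤x)

    +-monoˡ-≤ᴴ : ∀ {x y} z → x ≤ᴴ y → x + z ≤ᴴ y + z
    +-monoˡ-≤ᴴ {x} {y} z (h , h∈ , x≤) =
      h , h∈ , ≤-trans (+-monoˡ-≤ z x≤) (≤-reflexive (xy∙z≈xz∙y y h z))

  quotient : OrderedAbelianGroup ℓ
  quotient = record
    { Carrier = Carrier
    ; _≈_     = _≈ᴴ_
    ; _≤_     = _≤ᴴ_
    ; _+_     = _+_
    ; 0#      = 0#
    ; -_      = -_
    ; isAbelianGroup = record
      { isGroup = record
        { isMonoid = record
          { isSemigroup = record
            { isMagma = record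
              { isEquivalence = record
                { refl  = ≈⇒≈ᴴ refl
                ; sym   = ≈ᴴ-sym
                ; trans = ≈ᴴ-trans
                }
              ; ∙-cong = +-congᴴ
              }
            ; assoc = λ x y z → ≈⇒≈ᴴ (+-assoc x y z)
            }
          ; identity = (λ x → ≈⇒≈ᴴ (+-identityˡ x)) , (λ x → ≈⇒≈ᴴ (+-identityʳ x))
          }
        ; inverse = (λ x → ≈⇒≈ᴴ (-‿inverseˡ x)) , (λ x → ≈⇒≈ᴴ (-‿inverseʳ x))
        ; ⁻¹-cong = -‿congᴴ
        }
      ; comm = λ x y → ≈⇒≈ᴴ (+-comm x y)
      }
    ; isTotalOrder = record
      { isPartialOrder = record
        { isPreorder = record
          { isEquivalence = record
            { refl  = ≈⇒≈ᴴ refl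
            ; sym   = ≈ᴴ-sym
            ; trans = ≈ᴴ-trans
            }
          ; reflexive = ≤ᴴ-reflexive
          ; trans     = ≤ᴴ-trans
          }
        ; antisym = ≤ᴴ-antisym
        }
      ; total = ≤ᴴ-total
      }
    ; +-monoˡ-≤ = +-monoˡ-≤ᴴ
    }

module _ (G : OrderedAbelianGroup ℓ) where
  open OrderedAbelianGroup G

  record IsomorphicToℤ (H : ConvexSubgroup G) : Set ℓ where
    open ConvexSubgroup H
    field
      φ                   : ℤ → Carrier
      isGroupHomomorphism : IsGroupHomomorphism ℤ.+-0-rawGroup rawGroup φ
      isOrderMonomorphism : IsOrderMonomorphism _≡_ _≈_ ℤ._≤_ _≤_ φ
      image               : ∀ x → Member x ⇔ (∃[ n ] φ n ≈ x)

  IsℤGroup : Set (suc ℓ)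
  IsℤGroup = Σ[ H ∈ ConvexSubgroup G ] IsomorphicToℤ H × Divisible (quotient G H)

  -- G/ℤ, where ℤ is the convex subgroup generated by the least positive
  -- element e.
  quotientByℤ : ∀ {e} → IsLeastPositive G e → OrderedAbelianGroup ℓ
  quotientByℤ {e} e-least = quotient G (generated G e (proj₁ (IsLeastPositive.positive e-least)))

{-# OPTIONS --safe #-}
module Submission where

open import Level using (Level; Lift; lift) renaming (suc to lsuc)
open import Algebra.Bundles using (AbelianGroup)
open import Axiom.ExcludedMiddle using (ExcludedMiddle)
open import Axiom.Extensionality.Propositional using (Extensionality)
open import Axiom.UniquenessOfIdentityProofs.WithK using (uip)
open import Data.Bool.Base using (Bool; T)
open import Data.Empty using (⊥; ⊥-elim)
open import Data.Integer.Base as ℤ using (ℤ; +_; -[1+_])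
import Data.Integer.Properties as ℤ
open import Data.Maybe.Base using (Maybe; just; nothing; fromMaybe; maybe)
open import Data.Maybe.Properties using (just-injective)
open import Data.Nat.Base as ℕ using (ℕ; zero; suc)
import Data.Nat.Properties as ℕ
open import Data.Product.Base using (∃; ∃-syntax; _×_; _,_; proj₁; proj₂)
open import Data.Sum.Base using (_⊎_; inj₁; inj₂; [_,_]′)
open import Data.Unit.Base using (⊤)
open import Function.Base using (_∘_; id; const; case_of_)
open import Function.Bundles using (Injection; Inverse; _⇔_; mk⇔)
open import Function.Construct.Composition using () renaming (injection to _⨾_)
open import Function.Construct.Identity using () renaming (inverse to id-inverse)
open import Function.Construct.Symmetry using () renaming (inverse to inverse-sym)
open import Function.Properties.Inverse using (Inverse⇒Injection)
open import Induction.WellFounded using (WellFounded; Acc; acc; module All; module FixPoint)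
open import Relation.Binary.Bundles using (Setoid; TotalOrder)
open import Relation.Binary.Core using (Rel)
open import Relation.Binary.Definitions using (tri<; tri≈; tri>)
import Relation.Binary.Construct.Flip.EqAndOrd as Flip
open import Relation.Binary.PropositionalEquality.Core as ≡ using (_≡_; cong; subst)
open import Relation.Binary.PropositionalEquality.Properties using (setoid)
import Relation.Binary.Reasoning.PartialOrder as ≤-Reasoning
open import Relation.Nullary.Decidable
  using (Dec; yes; no; True; isYes; toWitness; fromWitness; decidable-stable)
open import Relation.Nullary.Negation using (¬_; contradiction)
open import Relation.Unary using (Pred)
open import Defs

-- A chain of intervals with empty intersection yields a nonprincipal cut together with
-- convergent maps between its two sides in both directions, so the sides have the same
-- cofinality; conversely, equal cofinalities on the two sides of a cut give monotone sequences
-- of the same minimal ordinal length closing in on it from below and above. A nonprincipal cut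
-- of G is invariant under translation by the least positive element, so it is a cut of G/ℤ, and
-- every cut of G/ℤ arises in this way. Passing to G/ℤ preserves the cofinality of either side,
-- except that ω may become 1; hence asymmetry in G amounts to strong asymmetry in G/ℤ.
-- Divisibility of G/ℤ follows from spherical completeness by a division algorithm.

-- The definitions see cofinality only through injections and bijections between subsets, whereas a
-- chain of intervals closing in on a cut calls for sequences indexed by ordinals. The bridge is a
-- cofinal sequence of least ordinal length: its image attains the cofinality, it can be made
-- monotone, and equal cofinalities give equal lengths, so that the sequences on the two sides of a
-- cut can be paired index by index. Two obstacles shape the construction. Ordinals that outrun
-- every set in `Set ℓ` live in the next universe, so subsets described through them must be brought
-- back to level `ℓ`. And choices made by excluded middle need not respect setoid equality, so they
-- are made on canonical representatives.

private
  variable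
    a b p q r ℓ : Level

-- Choice, resizing and canonical representatives from excluded middle

module Classical (em : ∀ a → ExcludedMiddle a) (ext : ∀ a b → Extensionality a b) where

  dec : (P : Set a) → Dec P
  dec P = em _ {P}

  by-contradiction : {P : Set a} → ¬ ¬ P → P
  by-contradiction = decidable-stable (dec _)

  ¬∀⇒∃¬ : {A : Set a} {P : A → Set p} → ¬ (∀ x → P x) → ∃[ x ] ¬ P x
  ¬∀⇒∃¬ ¬∀ = by-contradiction λ ¬∃ → ¬∀ λ x → by-contradiction λ ¬p → ¬∃ (x , ¬p)

  -- Deciding `P` reduces it to a Boolean, whose truth type can be lifted to any universe. This
  -- turns conditions that quantify over ordinals into predicates of level `ℓ`.
  Resize : ∀ b → Set a → Set b
  Resize b P = Lift b (True (dec P))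

  resize : {P : Set a} → P → Resize b P
  resize p = lift (fromWitness p)

  unresize : {P : Set a} → Resize b P → P
  unresize (lift t) = toWitness t

  -- Excluded middle decides inhabitation of arbitrary types by exhibiting an
  -- inhabitant, so it acts as a global choice operator.
  pick : {A : Set a} → Pred A p → Maybe A
  pick P with dec (∃ P)
  ... | yes (x , _) = just x
  ... | no _        = nothing

  pick-just : {A : Set a} (P : Pred A p) {x : A} → pick P ≡ just x → P x
  pick-just P eq with dec (∃ P)
  pick-just P ≡.refl | yes (_ , px) = px

  pick-nothing : {A : Set a} (P : Pred A p) → pick P ≡ nothing → ¬ ∃ P
  pick-nothing P eq with dec (∃ P)
  pick-nothing P ≡.refl | no ¬∃ = ¬∃

  choose : {A : Set a} → A → Pred A p → A
  choose x₀ P = fromMaybe x₀ (pick P)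

  choose-satisfies : {A : Set a} (x₀ : A) (P : Pred A p) → ∃ P → P (choose x₀ P)
  choose-satisfies x₀ P ∃P with dec (∃ P)
  ... | yes (_ , px) = px
  ... | no ¬∃P       = contradiction ∃P ¬∃P

  -- A function chosen on the carrier need not respect `_≈_`; precomposed with `rep` it does,
  -- because equivalent elements get propositionally equal representatives.
  module Representative (S : Setoid a p) where
    open Setoid S using (Carrier; _≈_) renaming (refl to ≈-refl; sym to ≈-sym; trans to ≈-trans)

    private
      -- By extensionality, equivalent elements have the same Boolean-valued class.
      class : Carrier → Carrier → Bool
      class x y = isYes (dec (x ≈ y))

      class-cong : ∀ {x y} → x ≈ y → class x ≡ class y
      class-cong {x} {y} x≈y = ext _ _ λ z → helper z (dec (x ≈ z)) (dec (y ≈ z))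
        where
        helper : ∀ z (p : Dec (x ≈ z)) (q : Dec (y ≈ z)) → isYes p ≡ isYes q
        helper z (yes _) (yes _) = ≡.refl
        helper z (no _)  (no _)  = ≡.refl
        helper z (yes p) (no ¬q) = contradiction (≈-trans (≈-sym x≈y) p) ¬q
        helper z (no ¬p) (yes q) = contradiction (≈-trans x≈y q) ¬p

      picked : ∀ x → ∃[ y ] pick (T ∘ class x) ≡ just y × x ≈ y
      picked x with pick (T ∘ class x) in eq
      ... | just y  = y , ≡.refl , toWitness (pick-just (T ∘ class x) eq)
      ... | nothing = contradiction (x , fromWitness ≈-refl) (pick-nothing (T ∘ class x) eq)

    abstract
      rep : Carrier → Carrier
      rep x = proj₁ (picked x)

      rep-≈ : ∀ x → x ≈ rep x
      rep-≈ x = proj₂ (proj₂ (picked x))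

      rep-cong : ∀ {x y} → x ≈ y → rep x ≡ rep y
      rep-cong {x} {y} x≈y = just-injective
        (≡.trans (≡.sym (proj₁ (proj₂ (picked x))))
        (≡.trans (cong (λ c → pick (T ∘ c)) (class-cong x≈y)) (proj₁ (proj₂ (picked y)))))

  minimum : {A : Set a} {_<_ : Rel A r} → WellFounded _<_ → (P : Pred A p) → ∃ P →
          ∃[ x ] P x × (∀ {y} → y < x → ¬ P y)
  minimum {_<_ = _<_} wf P (x , px) = by-contradiction λ ¬least →
    All.wfRec wf _ (λ x → ¬ P x) (λ x below px → ¬least (x , px , λ {_} → below)) x px

  -- Ordinals as ranks of trees, and the well-ordering theorem

  module Ordinals (ℓ : Level) where

    -- A tree stands for its rank, `sup A f` for the least ordinal strictly above the ranks of all
    -- `f x`; the relations below compare ranks.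
    data Tree : Set (lsuc ℓ) where
      sup : (A : Set ℓ) → (A → Tree) → Tree

    infix 4 _≤ᵗ_ _<ᵗ_
    _≤ᵗ_ _<ᵗ_ : Rel Tree ℓ
    sup A f ≤ᵗ sup B g = ∀ x → ∃[ y ] f x ≤ᵗ g y
    x <ᵗ sup B g = ∃[ y ] x ≤ᵗ g y

    ≤ᵗ-refl : ∀ x → x ≤ᵗ x
    ≤ᵗ-refl (sup A f) x = x , ≤ᵗ-refl (f x)

    ≤ᵗ-trans : ∀ {x y z} → x ≤ᵗ y → y ≤ᵗ z → x ≤ᵗ z
    ≤ᵗ-trans {sup _ _} {sup _ _} {sup _ _} x≤y y≤z u with x≤y u
    ... | v , fu≤gv with y≤z v
    ... | w , gv≤hw = w , ≤ᵗ-trans fu≤gv gv≤hw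

    <-≤ᵗ-trans : ∀ {x y z} → x <ᵗ y → y ≤ᵗ z → x <ᵗ z
    <-≤ᵗ-trans {y = sup _ _} {sup _ _} (u , x≤gu) y≤z with y≤z u
    ... | w , gu≤hw = w , ≤ᵗ-trans x≤gu gu≤hw

    <ᵗ⇒≤ᵗ : ∀ {x y} → x <ᵗ y → x ≤ᵗ y
    <ᵗ⇒≤ᵗ {sup A f} {sup B g} (y , x≤gy) u =
      y , <ᵗ⇒≤ᵗ (<-≤ᵗ-trans {f u} {sup A f} {g y} (u , ≤ᵗ-refl (f u)) x≤gy)

    <ᵗ-wellFounded : WellFounded _<ᵗ_
    <ᵗ-wellFounded x = accessible (≤ᵗ-refl x)
      where
      -- Quantifying over all `y` below `x` makes the recursion structural in `x`: whatever is
      -- strictly below `y` lies below an immediate subtree of `x`.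
      accessible : ∀ {x y} → y ≤ᵗ x → Acc _<ᵗ_ y
      accessible {sup A f} y≤x = acc λ z<y → case <-≤ᵗ-trans z<y y≤x of λ where
        (u , z≤fu) → accessible {f u} z≤fu

    ≤ᵗ-or->ᵗ : ∀ x y → x ≤ᵗ y ⊎ y <ᵗ x
    ≤ᵗ-or->ᵗ x y with dec (x ≤ᵗ y)
    ... | yes x≤y = inj₁ x≤y
    ... | no x≰y  = inj₂ (≰⇒> x y x≰y)
      where
      ≰⇒> : ∀ x y → ¬ x ≤ᵗ y → y <ᵗ x
      ≰⇒> (sup A f) (sup B g) x≰y with ¬∀⇒∃¬ x≰y
      -- A child `f u` that lies below no `g y` is, by recursion, strictly above each of them, hence
      -- dominates `sup B g`.
      ... | u , fu≰g = u , below (f u) fu≰g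
        where
        below : ∀ z → ¬ (∃[ y ] z ≤ᵗ g y) → sup B g ≤ᵗ z
        below (sup C h) z≰g v = ≰⇒> (sup C h) (g v) λ z≤gv → z≰g (v , z≤gv)

    treeSetoid : Setoid (lsuc ℓ) ℓ
    treeSetoid = record
      { Carrier       = Tree
      ; _≈_           = λ x y → x ≤ᵗ y × y ≤ᵗ x
      ; isEquivalence = record
        { refl  = λ {x} → ≤ᵗ-refl x , ≤ᵗ-refl x
        ; sym   = λ (p , q) → q , p
        ; trans = λ (p , q) (p′ , q′) → ≤ᵗ-trans p p′ , ≤ᵗ-trans q′ q
        }
      }

    open Representative treeSetoid

    -- Keeping only canonical trees makes `_≡_` the equality of ranks, so sequences indexed by
    -- ordinals carry no congruence obligations.
    Ordinal : Set (lsuc ℓ)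
    Ordinal = ∃[ x ] rep x ≡ x

    infix 4 _≺_
    record _≺_ (α β : Ordinal) : Set ℓ where
      constructor tree-<
      field
        tree : proj₁ α <ᵗ proj₁ β

    open _≺_

    ≺-wellFounded : WellFounded _≺_
    ≺-wellFounded (x , _) = lift-acc (<ᵗ-wellFounded x)
      where
      lift-acc : ∀ {x eq} → Acc _<ᵗ_ x → Acc _≺_ (x , eq)
      lift-acc (acc rs) = acc λ y≺x → lift-acc (rs (tree y≺x))

    ≺-total : ∀ α β → α ≡ β ⊎ α ≺ β ⊎ β ≺ α
    ≺-total (x , x≡) (y , y≡) with ≤ᵗ-or->ᵗ x y | ≤ᵗ-or->ᵗ y x
    ... | inj₂ y<x | _        = inj₂ (inj₂ (tree-< y<x))
    ... | inj₁ _   | inj₂ x<y = inj₂ (inj₁ (tree-< x<y))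
    ... | inj₁ x≤y | inj₁ y≤x =
        inj₁ (equal (≡.trans (≡.sym x≡) (≡.trans (rep-cong (x≤y , y≤x)) y≡)) x≡ y≡)
      where
      equal : ∀ {x y} → x ≡ y → (x≡ : rep x ≡ x) (y≡ : rep y ≡ y) → (x , x≡) ≡ (y , y≡)
      equal ≡.refl x≡ y≡ = cong (_ ,_) (uip x≡ y≡)

    -- No type in `Set ℓ` indexes an unbounded family of ordinals; this is what forces a transfinite
    -- enumeration of such a type to stop.
    above : {A : Set ℓ} (f : A → Ordinal) → ∃[ β ] ∀ x → f x ≺ β
    above {A} f = (rep s , ≡.sym (rep-cong (rep-≈ s))) ,
      λ x → tree-< (<-≤ᵗ-trans {y = s} (x , ≤ᵗ-refl (proj₁ (f x))) (proj₁ (rep-≈ s)))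
      where
      s : Tree
      s = sup A (proj₁ ∘ f)

    abstract
      recursion : {B : Set b} (step : ∀ β → (∀ γ → γ ≺ β → B) → B) →
                  ∃ λ (g : Ordinal → B) → ∀ β → g β ≡ step β (λ γ _ → g γ)
      recursion {B = B} step = All.wfRec ≺-wellFounded _ _ step′ , λ _ → unfold-wfRec
        where
        step′ : ∀ β → (∀ {γ} → γ ≺ β → B) → B
        step′ β below = step β λ _ → below
        open FixPoint ≺-wellFounded (λ _ → B) step′
          (λ β eq → cong (step β) (ext _ _ λ _ → ext _ _ λ γ≺β → eq γ≺β))

    -- Zermelo's well-ordering: each stage picks an element inequivalent to all earlier ones, and
    -- the value `nothing` signals that none is left.
    module Greedy (S : Setoid ℓ ℓ) where
      open Setoid S using (Carrier; _≈_) renaming (refl to ≈-refl; sym to ≈-sym)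

      private
        Hits : Maybe Carrier → Pred Carrier ℓ
        Hits m s = ∃[ t ] m ≡ just t × t ≈ s

        step : ∀ β → (∀ γ → γ ≺ β → Maybe Carrier) → Maybe Carrier
        step β below = pick λ s → ¬ (∃[ γ ] ∃[ γ≺β ] Hits (below γ γ≺β) s)

      enumeration : Ordinal → Maybe Carrier
      enumeration = proj₁ (recursion step)

      private
        unfold : ∀ β → enumeration β ≡ step β (λ γ _ → enumeration γ)
        unfold = proj₂ (recursion step)

      fresh : ∀ {β γ s t} → γ ≺ β → enumeration γ ≡ just s → enumeration β ≡ just t → ¬ s ≈ t
      fresh {β} {γ} {s} γ≺β eq eq′ s≈t =
        pick-just _ (≡.trans (≡.sym (unfold β)) eq′) (γ , γ≺β , s , eq , s≈t)

      exhausted : ∀ {β} → enumeration β ≡ nothing →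
                  ∀ s → ∃[ γ ] γ ≺ β × ∃[ t ] enumeration γ ≡ just t × t ≈ s
      exhausted {β} eq s = by-contradiction λ ¬hit →
        pick-nothing _ (≡.trans (≡.sym (unfold β)) eq)
          (s , λ (γ , γ≺β , hit) → ¬hit (γ , γ≺β , hit))

      -- Otherwise a bound for indices of all elements would enumerate a repetition.
      terminates : ∃[ β ] enumeration β ≡ nothing
      terminates = β , stops (enumeration β) ≡.refl
        where
        Index : Carrier → Pred Ordinal _
        Index s γ = enumeration γ ≡ just s
        index : Carrier → Ordinal
        -- The default, for elements that are never enumerated, is a bound of the empty family.
        index s = choose (proj₁ (above {A = Lift ℓ ⊥} λ ())) (Index s)
        β : Ordinal
        β = proj₁ (above index)
        stops : ∀ m → enumeration β ≡ m → enumeration β ≡ nothing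
        stops nothing  eq = eq
        stops (just s) eq = contradiction ≈-refl
          (fresh (proj₂ (above index) s) (choose-satisfies _ (Index s) (β , eq)) eq)

-- Existence and comparison of cofinalities

module CofinalityTheory (em : ∀ a → ExcludedMiddle a) (ext : ∀ a b → Extensionality a b) where
  open Classical em ext

  module CantorBernstein {κ λ′ : Setoid ℓ ℓ} (f : Injection κ λ′) (g : Injection λ′ κ) where
    private
      module A = Setoid κ
      module B = Setoid λ′
      module f = Injection f
      module g = Injection g

      -- The elements whose history, traced back through `g` and `f` alternately, begins in `κ`
      -- outside the range of `g`. The bijection follows `f` on them and inverts `g` elsewhere.
      data FromA : A.Carrier → Set ℓ where
        start : ∀ {x} → ¬ (∃[ y ] g.to y A.≈ x) → FromA x
        step  : ∀ {x x′} → FromA x → g.to (f.to x) A.≈ x′ → FromA x′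

      FromA-resp : ∀ {x x′} → x A.≈ x′ → FromA x → FromA x′
      FromA-resp x≈x′ (start ¬y)  = start λ (y , gy≈x′) → ¬y (y , A.trans gy≈x′ (A.sym x≈x′))
      FromA-resp x≈x′ (step fr e) = step fr (A.trans e x≈x′)

      -- The bijection is first a relation: its values and preimages are arbitrary choices, and
      -- `functional` and `injective` yield both the congruences and the inverse laws for any such
      -- choices.
      R : A.Carrier → B.Carrier → Set ℓ
      R x y = FromA x × f.to x B.≈ y ⊎ ¬ FromA x × g.to y A.≈ x

      total : ∀ x → ∃ (R x)
      total x with dec (FromA x)
      ... | yes fr = f.to x , inj₁ (fr , B.refl)
      ... | no ¬fr = case by-contradiction (λ ¬y → ¬fr (start ¬y)) of λ where
        (y , gy≈x) → y , inj₂ (¬fr , gy≈x)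

      surjective : ∀ y → ∃[ x ] R x y
      surjective y with dec (FromA (g.to y))
      ... | yes (start ¬y)           = contradiction (y , A.refl) ¬y
      ... | yes (step {x} fr gfx≈gy) = x , inj₁ (fr , g.injective gfx≈gy)
      ... | no ¬fr                   = g.to y , inj₂ (¬fr , A.refl)

      functional : ∀ {x x′ y y′} → R x y → R x′ y′ → x A.≈ x′ → y B.≈ y′
      functional (inj₁ (_ , p)) (inj₁ (_ , q)) e = B.trans (B.sym p) (B.trans (f.cong e) q)
      functional (inj₁ (fr , _)) (inj₂ (¬fr , _)) e = contradiction (FromA-resp e fr) ¬fr
      functional (inj₂ (¬fr , _)) (inj₁ (fr , _)) e = contradiction (FromA-resp (A.sym e) fr) ¬fr
      functional (inj₂ (_ , p)) (inj₂ (_ , q)) e = g.injective (A.trans p (A.trans e (A.sym q)))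

      clash : ∀ {x x′ y y′} → FromA x → f.to x B.≈ y → ¬ FromA x′ → g.to y′ A.≈ x′ → ¬ y B.≈ y′
      clash fr p ¬fr q e = ¬fr (step fr (A.trans (g.cong (B.trans p e)) q))

      injective : ∀ {x x′ y y′} → R x y → R x′ y′ → y B.≈ y′ → x A.≈ x′
      injective (inj₁ (_ , p)) (inj₁ (_ , q)) e = f.injective (B.trans p (B.trans e (B.sym q)))
      injective (inj₁ (fr , p)) (inj₂ (¬fr , q)) e = contradiction e (clash fr p ¬fr q)
      injective (inj₂ (¬fr , p)) (inj₁ (fr , q)) e = contradiction (B.sym e) (clash fr q ¬fr p)
      injective (inj₂ (_ , p)) (inj₂ (_ , q)) e = A.trans (A.sym p) (A.trans (g.cong e) q)

    bijection : Inverse κ λ′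
    bijection = record
      { to        = proj₁ ∘ total
      ; from      = proj₁ ∘ surjective
      ; to-cong   = λ {x} {x′} → functional (proj₂ (total x)) (proj₂ (total x′))
      ; from-cong = λ {y} {y′} → injective (proj₂ (surjective y)) (proj₂ (surjective y′))
      ; inverse   = (λ {y} {x} → functional (proj₂ (total x)) (proj₂ (surjective y)))
                  , (λ {x} {y} → injective (proj₂ (surjective y)) (proj₂ (total x)))
      }

  open CantorBernstein using () renaming (bijection to cantor-bernstein)

  module _ (I : LinearOrder ℓ) where
    open TotalOrder I renaming (trans to ≤-trans; refl to ≤-refl)
    open Ordinals ℓ

    CofinalBelow : Ordinal → Set (lsuc ℓ)
    CofinalBelow α = ∃ λ (f : Ordinal → Carrier) → ∀ x → ∃[ β ] β ≺ α × x ≤ f β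

    -- The cofinality in ordinal form. Only the values of `seq` below `length` matter, and they need
    -- not be monotone.
    record Scale : Set (lsuc ℓ) where
      field
        length  : Ordinal
        seq     : Ordinal → Carrier
        cofinal : ∀ x → ∃[ β ] β ≺ length × x ≤ seq β
        minimal : ∀ {β} → β ≺ length → ¬ CofinalBelow β

    abstract
      scale : Carrier → Scale
      scale x₀ = record
        { length  = proj₁ shortest
        ; seq     = proj₁ (proj₁ (proj₂ shortest))
        ; cofinal = proj₂ (proj₁ (proj₂ shortest))
        ; minimal = proj₂ (proj₂ shortest)
        }
        where
        open Greedy Eq.setoid
        reaches : ∀ x → ∃[ β ] β ≺ proj₁ terminates × x ≤ fromMaybe x₀ (enumeration β)
        reaches x with exhausted (proj₂ terminates) x
        ... | β , β≺ , t , eq , t≈x = β , β≺ ,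
          reflexive (Eq.trans (Eq.sym t≈x) (Eq.reflexive (≡.sym (cong (fromMaybe x₀) eq))))
        shortest : ∃[ α ] CofinalBelow α × (∀ {β} → β ≺ α → ¬ CofinalBelow β)
        shortest = minimum ≺-wellFounded CofinalBelow
          (proj₁ terminates , fromMaybe x₀ ∘ enumeration , reaches)

  module _ {I : LinearOrder ℓ} (s : Scale I) where
    open TotalOrder I renaming (trans to ≤-trans; refl to ≤-refl)
    open Ordinals ℓ
    open Scale s

    image : Pred Carrier ℓ
    image x = Resize ℓ (∃[ β ] β ≺ length × seq β ≈ x)

    private
      -- A greedy enumeration of `S` cannot stop before `length`, since it would then be a shorter
      -- cofinal sequence. Hence a point of the image can be sent to the element of `S` enumerated
      -- at its position, and distinct positions receive distinct elements.
      module Embedding (S : Pred Carrier ℓ) (S-cofinal : Cofinal I S) where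
        open Greedy (subsetSetoid I S)
        open Representative (subsetSetoid I image)

        defined : ∀ {β} → β ≺ length → ∃[ t ] enumeration β ≡ just t
        defined {β} β≺ with enumeration β in eq
        ... | just t  = t , ≡.refl
        ... | nothing = contradiction (maybe proj₁ (seq β) ∘ enumeration , reaches) (minimal β≺)
          where
          reaches : ∀ x → ∃[ γ ] γ ≺ β × x ≤ maybe proj₁ (seq β) (enumeration γ)
          reaches x with S-cofinal x
          ... | y , Sy , x≤y with exhausted eq (y , Sy)
          ... | γ , γ≺β , t , eq′ , t≈y = γ , γ≺β , ≤-trans x≤y
            (reflexive (Eq.trans (Eq.sym t≈y)
              (Eq.reflexive (≡.sym (cong (maybe proj₁ (seq β)) eq′)))))

        position : ∀ z → ∃[ β ] β ≺ length × seq β ≈ proj₁ (rep z)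
        position z = unresize (proj₂ (rep z))

        value : ∀ z → ∃[ t ] enumeration (proj₁ (position z)) ≡ just t
        value z = defined (proj₁ (proj₂ (position z)))

        value-injective : ∀ {z z′} → proj₁ (proj₁ (value z)) ≈ proj₁ (proj₁ (value z′)) →
                          proj₁ z ≈ proj₁ z′
        value-injective {z} {z′} v≈v′ with ≺-total (proj₁ (position z)) (proj₁ (position z′))
        ... | inj₂ (inj₁ p≺p′) =
          contradiction v≈v′ (fresh p≺p′ (proj₂ (value z)) (proj₂ (value z′)))
        ... | inj₂ (inj₂ p′≺p) =
          contradiction (Eq.sym v≈v′) (fresh p′≺p (proj₂ (value z′)) (proj₂ (value z)))
        ... | inj₁ p≡p′ = Eq.trans (at z) (Eq.trans (Eq.reflexive (cong seq p≡p′)) (Eq.sym (at z′)))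
          where
          at : ∀ z → proj₁ z ≈ seq (proj₁ (position z))
          at z = Eq.trans (rep-≈ z) (Eq.sym (proj₂ (proj₂ (position z))))

        value-cong : ∀ {z z′} → proj₁ z ≈ proj₁ z′ →
                     proj₁ (proj₁ (value z)) ≈ proj₁ (proj₁ (value z′))
        value-cong {z} {z′} z≈z′ = Eq.reflexive
          (cong (λ w → proj₁ (proj₁ (defined (proj₁ (proj₂ (unresize (proj₂ w)))))))
            (rep-cong {z} {z′} z≈z′))

        embedding : Injection (subsetSetoid I image) (subsetSetoid I S)
        embedding = record
          { to        = λ z → proj₁ (value z)
          ; cong      = λ {z} {z′} → value-cong {z} {z′}
          ; injective = λ {z} {z′} → value-injective {z} {z′}
          }

    scale⇒isCofinality : IsCofinality I (subsetSetoid I image)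
    scale⇒isCofinality = record
      { subset       = image
      ; cofinal      = λ x → case cofinal x of λ where
          (β , β≺ , x≤) → seq β , resize (β , β≺ , Eq.refl) , x≤
      ; equinumerous = id-inverse _
      ; minimal      = Embedding.embedding
      }

    abstract
      -- The value at a stage is chosen above `seq` and above all earlier values. Such a bound
      -- exists before `length`: otherwise the earlier values would already be cofinal,
      -- contradicting minimality.
      monotone-scale : ∃ λ (h : Ordinal → Carrier) →
                       (∀ {β} → β ≺ length → seq β ≤ h β) ×
                       (∀ {β γ} → γ ≺ β → β ≺ length → h γ ≤ h β)
      monotone-scale = h , (λ β≺ → proj₁ (h-bound β≺)) , λ γ≺β β≺ → proj₂ (h-bound β≺) _ γ≺β
        where
        step : ∀ β → (∀ γ → γ ≺ β → Carrier) → Carrier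
        step β below = choose (seq β) λ y → seq β ≤ y × (∀ γ γ≺β → below γ γ≺β ≤ y)
        h : Ordinal → Carrier
        h = proj₁ (recursion step)

        Bound : Ordinal → Pred Carrier (lsuc ℓ)
        Bound β y = seq β ≤ y × (∀ γ → γ ≺ β → h γ ≤ y)

        bounded : ∀ {β} → β ≺ length → ∃ (Bound β)
        bounded {β} β≺ with ¬∀⇒∃¬ (λ reaches → minimal β≺ (h , reaches))
        ... | x , x-above with total x (seq β)
        ... | inj₁ x≤ = seq β , ≤-refl , λ γ γ≺β → case total (h γ) x of λ where
          (inj₁ hγ≤x) → ≤-trans hγ≤x x≤
          (inj₂ x≤hγ) → contradiction (γ , γ≺β , x≤hγ) x-above
        ... | inj₂ ≤x = x , ≤x , λ γ γ≺β → case total (h γ) x of λ where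
          (inj₁ hγ≤x) → hγ≤x
          (inj₂ x≤hγ) → contradiction (γ , γ≺β , x≤hγ) x-above

        h-bound : ∀ {β} → β ≺ length → Bound β (h β)
        h-bound {β} β≺ = subst (Bound β) (≡.sym (proj₂ (recursion step) β))
          (choose-satisfies (seq β) (Bound β) (bounded β≺))

  abstract
    isCofinality-exists : (I : LinearOrder ℓ) → TotalOrder.Carrier I → ∃ (IsCofinality I)
    isCofinality-exists I x₀ = _ , scale⇒isCofinality (scale I x₀)

  -- Turns a cardinal bound into a cofinal sequence, indexed by natural numbers or by ordinals below
  -- a given length. `R n k` reads "`n` names `k`"; as a name determines its element and the
  -- injection is injective, whatever is chosen at `n` equals the intended point.
  reindex : {A : LinearOrder ℓ} {κ : Setoid ℓ ℓ} {λ′ : Setoid b q} → TotalOrder.Carrier A →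
            IsCofinality A κ → Injection κ λ′ →
            {N : Set a} (P : Pred N p) (R : N → Setoid.Carrier λ′ → Set r) →
            (∀ {n k k′} → R n k → R n k′ → Setoid._≈_ λ′ k k′) →
            (∀ k → ∃[ n ] P n × R n k) →
            ∃ λ (s : N → TotalOrder.Carrier A) → ∀ x → ∃[ n ] P n × TotalOrder._≤_ A x (s n)
  reindex {A = A} {κ} x₀ κ-cf i {N} P R functional covers = s , reaches
    where
    open TotalOrder A renaming (trans to ≤-trans; refl to ≤-refl)
    open IsCofinality κ-cf
    module i = Injection i
    module e = Inverse equinumerous
    At : N → Pred Carrier _
    At n y = ∃[ k ] R n (i.to k) × proj₁ (e.to k) ≡ y
    s : N → Carrier
    s n = choose x₀ (At n)
    reaches : ∀ x → ∃[ n ] P n × x ≤ s n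
    reaches x with cofinal x
    ... | y , Sy , x≤y with covers (i.to (e.from (y , Sy)))
    ... | n , Pn , Rn with choose-satisfies x₀ (At n) (_ , e.from (y , Sy) , Rn , ≡.refl)
    ... | k , Rk , eq = n , Pn , ≤-trans x≤y (reflexive
      (Eq.trans (Eq.sym (e.inverseˡ (Setoid.refl κ)))
      (Eq.trans (e.to-cong (i.injective (functional Rn Rk))) (Eq.reflexive eq))))

  module _ (A B : LinearOrder ℓ) where
    private
      module A = TotalOrder A
      module B = TotalOrder B

    -- cf A ≤ cf B
    infix 4 _≼_
    _≼_ : Set (lsuc ℓ)
    _≼_ = ∀ κ λ′ → IsCofinality A κ → IsCofinality B λ′ → Injection κ λ′

    Convergent : (B.Carrier → A.Carrier) → Set ℓ
    Convergent f = ∀ x → ∃[ y ] ∀ z → y B.≤ z → x A.≤ f z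

  -- A convergent map sends cofinal subsets of B to cofinal subsets of A.
  convergent⇒≼ : (A B : LinearOrder ℓ) (f : TotalOrder.Carrier B → TotalOrder.Carrier A) →
                 Convergent A B f → A ≼ B
  convergent⇒≼ {ℓ} A B f convergent κ λ′ κ-cf λ-cf =
    (IsCofinality.minimal κ-cf S S-cofinal ⨾ S↣T) ⨾ Inverse⇒Injection (inverse-sym λ-equi)
    where
    module A = TotalOrder A
    module B = TotalOrder B
    open IsCofinality λ-cf renaming (cofinal to T-cofinal; equinumerous to λ-equi)
    module RepT = Representative (subsetSetoid B subset)

    -- The image of the cofinal subset under `f`, taken on representatives because `f` need not
    -- respect equality.
    S : Pred A.Carrier ℓ
    S x = ∃[ t ] f (proj₁ (RepT.rep t)) A.≈ x

    S-cofinal : Cofinal A S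
    S-cofinal x with convergent x
    ... | y , f-above with T-cofinal y
    ... | z , Tz , y≤z =
      f (proj₁ (RepT.rep t)) , (t , A.Eq.refl) ,
      f-above _ (B.trans y≤z (B.reflexive (RepT.rep-≈ t)))
      where t = z , Tz

    module RepS = Representative (subsetSetoid A S)

    S↣T : Injection (subsetSetoid A S) (subsetSetoid B subset)
    S↣T = record
      { to        = λ s → proj₁ (proj₂ (RepS.rep s))
      ; cong      = λ {s} {s′} s≈s′ →
          B.Eq.reflexive (cong (λ u → proj₁ (proj₁ (proj₂ u))) (RepS.rep-cong {s} {s′} s≈s′))
      ; injective = λ {s} {s′} t≈t′ → A.Eq.trans (preimage s)
          (A.Eq.trans (A.Eq.reflexive (cong (λ t → f (proj₁ t)) (RepT.rep-cong t≈t′)))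
            (A.Eq.sym (preimage s′)))
      }
      where
      preimage : ∀ s → proj₁ s A.≈ f (proj₁ (RepT.rep (proj₁ (proj₂ (RepS.rep s)))))
      preimage s = A.Eq.trans (RepS.rep-≈ s) (A.Eq.sym (proj₂ (proj₂ (RepS.rep s))))

-- Countable cofinality, cuts and coarsenings

module OrderTheory (em : ∀ a → ExcludedMiddle a) (ext : ∀ a b → Extensionality a b) where
  open Classical em ext
  open CofinalityTheory em ext
  open CantorBernstein using () renaming (bijection to cantor-bernstein)

  ∣_∣ : LinearOrder ℓ → Set ℓ
  ∣ I ∣ = TotalOrder.Carrier I

  ≼-refl : (A : LinearOrder ℓ) → A ≼ A
  ≼-refl A = convergent⇒≼ A A id λ x → x , λ _ x≤z → x≤z

  ≼-trans : {A B C : LinearOrder ℓ} → ∣ B ∣ → A ≼ B → B ≼ C → A ≼ C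
  ≼-trans {B = B} y₀ A≼B B≼C κ μ κ-cf μ-cf with isCofinality-exists B y₀
  ... | λ′ , λ-cf = A≼B κ λ′ κ-cf λ-cf ⨾ B≼C λ′ μ λ-cf μ-cf

  inverse⇒≼ : {A B : LinearOrder ℓ} {κ λ′ : Setoid ℓ ℓ} → IsCofinality A κ → IsCofinality B λ′ →
              Inverse κ λ′ → A ≼ B
  inverse⇒≼ {A = A} {B} κ-cf λ-cf κ≃λ κ₁ λ₁ κ₁-cf λ₁-cf =
    (≼-refl A κ₁ _ κ₁-cf κ-cf ⨾ Inverse⇒Injection κ≃λ) ⨾ ≼-refl B _ λ₁ λ-cf λ₁-cf

  Equicofinal : LinearOrder ℓ → LinearOrder ℓ → Set (lsuc ℓ)
  Equicofinal A B = (A ≼ B) × (B ≼ A)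

  module _ (I : LinearOrder ℓ) where
    open TotalOrder I

    NoMaximum : Set ℓ
    NoMaximum = ∀ x → ∃[ y ] ¬ y ≤ x

    -- Covers cofinality 1 as well as ω, since a constant sequence at a maximum qualifies.
    CountablyCofinal : Set ℓ
    CountablyCofinal = ∃ λ (s : ℕ → Carrier) → ∀ x → ∃[ n ] x ≤ s n

  ¬countable⇒noMaximum : (I : LinearOrder ℓ) → ¬ CountablyCofinal I → NoMaximum I
  ¬countable⇒noMaximum I ¬cc x = ¬∀⇒∃¬ λ x-max → ¬cc (const x , λ y → 0 , x-max y)

  countable⇒injection : (I : LinearOrder ℓ) {κ : Setoid ℓ ℓ} → CountablyCofinal I →
                        IsCofinality I κ → Injection κ (setoid ℕ)
  countable⇒injection {ℓ} I (s , reaches) κ-cf =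
    IsCofinality.minimal κ-cf S S-cofinal ⨾ record
      { to        = λ x → index (rep x)
      ; cong      = λ {x} {y} x≈y → cong index (rep-cong {x} {y} x≈y)
      ; injective = λ {x} {y} eq →
          Eq.trans (at x) (Eq.trans (Eq.reflexive (cong s eq)) (Eq.sym (at y)))
      }
    where
    open TotalOrder I using (Carrier; _≈_; module Eq)
    S : Pred Carrier ℓ
    S x = ∃[ n ] s n ≈ x
    S-cofinal : Cofinal I S
    S-cofinal x with reaches x
    ... | n , x≤ = s n , (n , Eq.refl) , x≤
    open Representative (subsetSetoid I S)
    index : ∃ S → ℕ
    index x = proj₁ (proj₂ x)
    at : ∀ x → proj₁ x ≈ s (index (rep x))
    at x = Eq.trans (rep-≈ x) (Eq.sym (proj₂ (proj₂ (rep x))))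

  injection⇒countable : (I : LinearOrder ℓ) {κ : Setoid ℓ ℓ} → ∣ I ∣ → IsCofinality I κ →
                        Injection κ (setoid ℕ) → CountablyCofinal I
  injection⇒countable I x₀ κ-cf i
    with reindex x₀ κ-cf i (λ _ → ⊤) _≡_ (λ p q → ≡.trans (≡.sym p) q) (λ n → n , _ , ≡.refl)
  ... | s , reaches = s , λ x → case reaches x of λ where (n , _ , x≤) → n , x≤

  uncountable⇒¬countable : (I : LinearOrder ℓ) {κ : Setoid ℓ ℓ} → IsCofinality I κ →
                           Uncountable κ → ¬ CountablyCofinal I
  uncountable⇒¬countable I κ-cf unc cc = unc (countable⇒injection I cc κ-cf)

  ¬countable⇒uncountable : (I : LinearOrder ℓ) {κ : Setoid ℓ ℓ} → ∣ I ∣ → IsCofinality I κ →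
                           ¬ CountablyCofinal I → Uncountable κ
  ¬countable⇒uncountable I x₀ κ-cf ¬cc i = ¬cc (injection⇒countable I x₀ κ-cf i)

  uncountableCofinality⇒ : (I : LinearOrder ℓ) → UncountableCofinality I → ¬ CountablyCofinal I
  uncountableCofinality⇒ I (κ , κ-cf , unc) = uncountable⇒¬countable I κ-cf unc

  ⇒uncountableCofinality : (I : LinearOrder ℓ) → ∣ I ∣ → ¬ CountablyCofinal I →
                           UncountableCofinality I
  ⇒uncountableCofinality I x₀ ¬cc with isCofinality-exists I x₀
  ... | κ , κ-cf = κ , κ-cf , ¬countable⇒uncountable I x₀ κ-cf ¬cc

  countable-≼ : {A B : LinearOrder ℓ} → ∣ A ∣ → ∣ B ∣ → A ≼ B →
                CountablyCofinal B → CountablyCofinal A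
  countable-≼ {A = A} {B} x₀ y₀ A≼B cc with isCofinality-exists A x₀ | isCofinality-exists B y₀
  ... | κ , κ-cf | λ′ , λ-cf =
    injection⇒countable A x₀ κ-cf (A≼B κ λ′ κ-cf λ-cf ⨾ countable⇒injection B cc λ-cf)

  noMaximum⇒infinite : (I : LinearOrder ℓ) {κ : Setoid ℓ ℓ} → ∣ I ∣ → NoMaximum I →
                       IsCofinality I κ → Injection (setoid ℕ) κ
  noMaximum⇒infinite I x₀ noMax κ-cf = record
    { to        = s
    ; cong      = λ {m} {n} m≡n → Eq.reflexive (cong (λ k → proj₁ (s k)) m≡n)
    ; injective = s-injective
    } ⨾ Inverse⇒Injection (inverse-sym equinumerous)
    where
    open TotalOrder I renaming (trans to ≤-trans; refl to ≤-refl)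
    open IsCofinality κ-cf

    beyond : ∀ x → ∃ λ (y : ∃ subset) → ¬ proj₁ y ≤ x
    beyond x with noMax x
    ... | y , y≰x with cofinal y
    ... | z , Sz , y≤z = (z , Sz) , λ z≤x → y≰x (≤-trans y≤z z≤x)

    s : ℕ → ∃ subset
    s zero    = proj₁ (beyond x₀)
    s (suc n) = proj₁ (beyond (proj₁ (s n)))

    increasing : ∀ {m n} → m ℕ.< n → ¬ proj₁ (s n) ≤ proj₁ (s m)
    increasing {m} {suc n} (ℕ.s≤s m≤n) s₁₊ₙ≤sₘ with total (proj₁ (s n)) (proj₁ (s m))
    ... | inj₂ sₘ≤sₙ = proj₂ (beyond (proj₁ (s n))) (≤-trans s₁₊ₙ≤sₘ sₘ≤sₙ)
    ... | inj₁ sₙ≤sₘ with ℕ.m≤n⇒m<n∨m≡n m≤n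
    ... | inj₁ m<n  = increasing m<n sₙ≤sₘ
    ... | inj₂ ≡.refl = proj₂ (beyond (proj₁ (s n))) s₁₊ₙ≤sₘ

    s-injective : ∀ {m n} → proj₁ (s m) ≈ proj₁ (s n) → m ≡ n
    s-injective {m} {n} sₘ≈sₙ with ℕ.<-cmp m n
    ... | tri< m<n _ _ = contradiction (reflexive (Eq.sym sₘ≈sₙ)) (increasing m<n)
    ... | tri≈ _ m≡n _ = m≡n
    ... | tri> _ _ n<m = contradiction (reflexive sₘ≈sₙ) (increasing n<m)

  countable⇒≼ : {A B : LinearOrder ℓ} → CountablyCofinal A → ∣ B ∣ → NoMaximum B → A ≼ B
  countable⇒≼ {A = A} {B} cc y₀ noMax κ λ′ κ-cf λ-cf =
    countable⇒injection A cc κ-cf ⨾ noMaximum⇒infinite B y₀ noMax λ-cf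

  module _ {I : LinearOrder ℓ} (C : Cut I) where
    open Cut C

    lowerPart upperPart : LinearOrder ℓ
    lowerPart = restrict I D
    upperPart = Flip.totalOrder (restrict I E)

    asymmetric⇒¬equicofinal : Asymmetric C → ¬ Equicofinal lowerPart upperPart
    asymmetric⇒¬equicofinal (κ , λ′ , (κ-cf , λ-cf) , κ≄λ) (D≼E , E≼D) =
      κ≄λ (cantor-bernstein (D≼E κ λ′ κ-cf λ-cf) (E≼D λ′ κ λ-cf κ-cf))

    private
      cofD = isCofinality-exists lowerPart D-nonempty
      cofE = isCofinality-exists upperPart E-nonempty

      ¬inverse : ¬ Equicofinal lowerPart upperPart → ¬ Inverse (proj₁ cofD) (proj₁ cofE)
      ¬inverse ¬equi κ≃λ = ¬equi
        ( inverse⇒≼ (proj₂ cofD) (proj₂ cofE) κ≃λ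
        , inverse⇒≼ (proj₂ cofE) (proj₂ cofD) (inverse-sym κ≃λ))

    ¬equicofinal⇒asymmetric : ¬ Equicofinal lowerPart upperPart → Asymmetric C
    ¬equicofinal⇒asymmetric ¬equi =
      _ , _ , (proj₂ cofD , proj₂ cofE) , ¬inverse ¬equi

    stronglyAsymmetric⇒¬countable : StronglyAsymmetric C →
                                    ¬ (CountablyCofinal lowerPart × CountablyCofinal upperPart)
    stronglyAsymmetric⇒¬countable (_ , _ , (κ-cf , _) , _ , inj₁ unc) (cc , _) =
      uncountable⇒¬countable lowerPart κ-cf unc cc
    stronglyAsymmetric⇒¬countable (_ , _ , (_ , λ-cf) , _ , inj₂ unc) (_ , cc) =
      uncountable⇒¬countable upperPart λ-cf unc cc

    stronglyAsymmetric⇒asymmetric : StronglyAsymmetric C → Asymmetric C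
    stronglyAsymmetric⇒asymmetric (κ , λ′ , cf , κ≄λ , _) = κ , λ′ , cf , κ≄λ

    ⇒stronglyAsymmetric : ¬ Equicofinal lowerPart upperPart →
                          ¬ (CountablyCofinal lowerPart × CountablyCofinal upperPart) →
                          StronglyAsymmetric C
    ⇒stronglyAsymmetric ¬equi ¬cc =
      _ , _ , (proj₂ cofD , proj₂ cofE) , ¬inverse ¬equi , uncountable
      where
      uncountable : Uncountable (proj₁ cofD) ⊎ Uncountable (proj₁ cofE)
      uncountable with dec (CountablyCofinal lowerPart)
      ... | no ¬ccD = inj₁ (¬countable⇒uncountable lowerPart D-nonempty (proj₂ cofD) ¬ccD)
      ... | yes ccD = inj₂ (¬countable⇒uncountable upperPart E-nonempty (proj₂ cofE)
                              λ ccE → ¬cc (ccD , ccE))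

  -- A′ is (up to the map ι) the quotient of A by convex classes, each of which
  -- has a countable cofinal sequence.
  record Coarsening (A A′ : LinearOrder ℓ) : Set ℓ where
    private
      module A = TotalOrder A
      module A′ = TotalOrder A′
    field
      ι       : A.Carrier → A′.Carrier
      π       : A′.Carrier → A.Carrier
      mono    : ∀ {x y} → x A.≤ y → ι x A′.≤ ι y
      section : ∀ y → y A′.≤ ι (π y)
      shift   : A′.Carrier → ℕ → A.Carrier
      absorb  : ∀ {x y} → ι x A′.≤ y → ∃[ n ] x A.≤ shift y n

    countable⇒ : CountablyCofinal A → CountablyCofinal A′
    countable⇒ (s , reaches) = ι ∘ s , λ y → case reaches (π y) of λ where
      (n , πy≤) → n , A′.trans (section y) (mono πy≤)

    ≰⇒π-≥ : ∀ {x y} → ¬ y A′.≤ ι x → x A.≤ π y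
    ≰⇒π-≥ {x} {y} y≰x with A.total x (π y)
    ... | inj₁ x≤πy = x≤πy
    ... | inj₂ πy≤x = contradiction (A′.trans (section y) (mono πy≤x)) y≰x

    -- Without a maximum in `A′`, representatives of a cofinal sequence are cofinal in `A`. With a
    -- maximum `m`, the sequence through the top class is used instead.
    countable⇐ : CountablyCofinal A′ → CountablyCofinal A
    countable⇐ (s , reaches) with dec (NoMaximum A′)
    ... | yes noMax = π ∘ s , λ x → case noMax (ι x) of λ where
      (y , y≰x) → case reaches y of λ where
        (n , y≤s) → n , ≰⇒π-≥ λ s≤x → y≰x (A′.trans y≤s s≤x)
    ... | no ¬noMax with ¬∀⇒∃¬ ¬noMax
    ... | m , m-max = shift m , λ x → absorb (by-contradiction λ x≰m → m-max (ι x , x≰m))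

    ≼-coarse : A′ ≼ A
    ≼-coarse = convergent⇒≼ A′ A ι λ y → π y , λ z πy≤z → A′.trans (section y) (mono πy≤z)

    -- Without a top class, every `x` has a class strictly beyond its own, and all representatives
    -- from there on lie above `x`.
    coarse-≼ : NoMaximum A′ → A ≼ A′
    coarse-≼ noMax = convergent⇒≼ A A′ π λ x → case noMax (ι x) of λ where
      (y , y≰x) → y , λ z y≤z → ≰⇒π-≥ λ z≤x → y≰x (A′.trans y≤z z≤x)

  module _ {A A′ B B′ : LinearOrder ℓ} (cA : Coarsening A A′) (cB : Coarsening B B′)
           (x₀ : ∣ A ∣) (y₀ : ∣ B ∣) where
    private
      module cA = Coarsening cA
      module cB = Coarsening cB

      ¬countable⇒¬countable : Equicofinal A B ⊎ Equicofinal A′ B′ →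
                              (¬ CountablyCofinal A′ → ¬ CountablyCofinal B′) ×
                              (¬ CountablyCofinal B′ → ¬ CountablyCofinal A′)
      ¬countable⇒¬countable (inj₁ (A≼B , B≼A)) =
        (λ ¬ccA ccB → ¬ccA (cA.countable⇒ (countable-≼ x₀ y₀ A≼B (cB.countable⇐ ccB)))) ,
        (λ ¬ccB ccA → ¬ccB (cB.countable⇒ (countable-≼ y₀ x₀ B≼A (cA.countable⇐ ccA))))
      ¬countable⇒¬countable (inj₂ (A≼B , B≼A)) =
        (λ ¬ccA ccB → ¬ccA (countable-≼ (cA.ι x₀) (cB.ι y₀) A≼B ccB)) ,
        (λ ¬ccB ccA → ¬ccB (countable-≼ (cB.ι y₀) (cA.ι x₀) B≼A ccA))

      -- Equicofinality at either level carries countability from one side to the other. So if the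
      -- two coarse sides are not both countably cofinal, neither is, and neither has a maximum.
      neither : Equicofinal A B ⊎ Equicofinal A′ B′ →
                ¬ (CountablyCofinal A′ × CountablyCofinal B′) →
                NoMaximum A′ × NoMaximum B′
      neither equi ¬both =
        ¬countable⇒noMaximum A′ ¬ccA ,
        ¬countable⇒noMaximum B′ (proj₁ (¬countable⇒¬countable equi) ¬ccA)
        where
        ¬ccA : ¬ CountablyCofinal A′
        ¬ccA ccA with dec (CountablyCofinal B′)
        ... | yes ccB = ¬both (ccA , ccB)
        ... | no ¬ccB = proj₂ (¬countable⇒¬countable equi) ¬ccB ccA

    equicofinal-coarse : ¬ (CountablyCofinal A′ × CountablyCofinal B′) →
                         Equicofinal A B → Equicofinal A′ B′
    equicofinal-coarse ¬both (A≼B , B≼A) with neither (inj₁ (A≼B , B≼A)) ¬both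
    ... | noMaxA , noMaxB =
      ≼-trans x₀ cA.≼-coarse (≼-trans y₀ A≼B (cB.coarse-≼ noMaxB)) ,
      ≼-trans y₀ cB.≼-coarse (≼-trans x₀ B≼A (cA.coarse-≼ noMaxA))

    equicofinal-fine : ¬ (CountablyCofinal A′ × CountablyCofinal B′) →
                       Equicofinal A′ B′ → Equicofinal A B
    equicofinal-fine ¬both (A≼B , B≼A) with neither (inj₂ (A≼B , B≼A)) ¬both
    ... | noMaxA , noMaxB =
      ≼-trans (cA.ι x₀) (cA.coarse-≼ noMaxA) (≼-trans (cB.ι y₀) A≼B cB.≼-coarse) ,
      ≼-trans (cB.ι y₀) (cB.coarse-≼ noMaxB) (≼-trans (cA.ι x₀) B≼A cA.≼-coarse)

    countable-fine : NoMaximum A → NoMaximum B →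
                     CountablyCofinal A′ × CountablyCofinal B′ → Equicofinal A B
    countable-fine noMaxA noMaxB (ccA , ccB) =
      countable⇒≼ (cA.countable⇐ ccA) y₀ noMaxB , countable⇒≼ (cB.countable⇐ ccB) x₀ noMaxA

  -- R relates the endpoints of the intervals in a chain; B carries the reversed order, so
  -- going up in both A and B shrinks the interval.
  module _ {A B : LinearOrder ℓ} where
    private
      module A = TotalOrder A
      module B = TotalOrder B

    nested⇒≼ : (R : A.Carrier → B.Carrier → Set ℓ) →
               (∀ {x y x′ y′} → R x y → R x′ y′ → x A.≤ x′ × y B.≤ y′ ⊎ x′ A.≤ x × y′ B.≤ y) →
               (∀ x → ∃[ x′ ] ∃[ y′ ] R x′ y′ × x A.≤ x′) →
               (∀ y → ∃[ x′ ] ∃[ y′ ] R x′ y′ × y B.≤ y′) →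
               NoMaximum B → A ≼ B
    nested⇒≼ R nested reachA reachB noMax = convergent⇒≼ A B (λ y → proj₁ (reachB y)) convergent
      where
      convergent : ∀ x → ∃[ y ] ∀ z → y B.≤ z → x A.≤ proj₁ (reachB z)
      convergent x with reachA x
      ... | x₁ , y₁ , R₁ , x≤x₁ with noMax y₁
      -- Since `y` is strictly past `y₁`, an interval reaching `y` cannot contain the one with ends
      -- `x₁` and `y₁`; nesting puts it inside, so its other end is past `x`.
      ... | y , y≰y₁ = y , above
        where
        above : ∀ z → y B.≤ z → x A.≤ proj₁ (reachB z)
        above z y≤z with reachB z
        ... | x₂ , y₂ , R₂ , z≤y₂ with nested R₁ R₂
        ... | inj₁ (x₁≤x₂ , _) = A.trans x≤x₁ x₁≤x₂
        ... | inj₂ (_ , y₂≤y₁) = contradiction (B.trans y≤z (B.trans z≤y₂ y₂≤y₁)) y≰y₁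

  -- Chains of intervals and cuts

  module _ (I : LinearOrder ℓ) where
    open TotalOrder I renaming (trans to ≤-trans; refl to ≤-refl)
    open ClosedInterval

    -- The empty intersection of a chain of intervals is a cut whose two sides
    -- are cofinally approximated by the endpoints of the same chain.
    symmetricallyDComplete⇒sphericallyComplete : SymmetricallyDComplete I → SphericallyComplete I
    symmetricallyDComplete⇒sphericallyComplete dcomplete 𝓑 (J₀ , 𝓑J₀) chain =
      by-contradiction λ empty → absurd λ x x∈ → empty (x , λ {J} → x∈ {J})
      where
      lower≤ : ∀ {J K} → 𝓑 J → 𝓑 K → lower J ≤ upper K
      lower≤ {J} {K} 𝓑J 𝓑K with chain 𝓑J 𝓑K
      ... | inj₁ J⊆K = proj₂ (J⊆K (≤-refl , lower≤upper J))
      ... | inj₂ K⊆J = ≤-trans (proj₁ (K⊆J (≤-refl , lower≤upper K))) (lower≤upper K)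

      nested : ∀ {J K} → 𝓑 J → 𝓑 K →
               lower J ≤ lower K × upper K ≤ upper J ⊎ lower K ≤ lower J × upper J ≤ upper K
      nested {J} {K} 𝓑J 𝓑K with chain 𝓑J 𝓑K
      ... | inj₁ J⊆K =
        inj₂ (proj₁ (J⊆K (≤-refl , lower≤upper J)) , proj₂ (J⊆K (lower≤upper J , ≤-refl)))
      ... | inj₂ K⊆J =
        inj₁ (proj₁ (K⊆J (≤-refl , lower≤upper K)) , proj₂ (K⊆J (lower≤upper K , ≤-refl)))

      module _ (empty : ∀ x → ¬ (∀ {J} → 𝓑 J → points I J x)) where

        D E : Pred Carrier ℓ
        D x = ∃[ J ] 𝓑 J × x ≤ lower J
        E x = ∃[ J ] 𝓑 J × upper J ≤ x

        cover : ∀ x → D x ⊎ E x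
        cover x with dec (D x) | dec (E x)
        ... | yes Dx | _      = inj₁ Dx
        ... | no _   | yes Ex = inj₂ Ex
        ... | no ¬Dx | no ¬Ex = ⊥-elim (empty x inside)
          where
          inside : ∀ {J} → 𝓑 J → points I J x
          inside {J} 𝓑J with total x (lower J) | total (upper J) x
          ... | inj₁ x≤ | _       = contradiction (J , 𝓑J , x≤) ¬Dx
          ... | inj₂ _  | inj₁ ≤x = contradiction (J , 𝓑J , ≤x) ¬Ex
          ... | inj₂ ≤x | inj₂ x≤ = ≤x , x≤

        -- Every lower endpoint is below every upper endpoint, so `e ≤ d` would place `d` in all the
        -- intervals.
        D≰E : ∀ {d e} → D d → E e → ¬ e ≤ d
        D≰E {d} (J , 𝓑J , d≤) (K , 𝓑K , ≤e) e≤d = empty d λ 𝓑L →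
          ≤-trans (lower≤ 𝓑L 𝓑K) (≤-trans ≤e e≤d) , ≤-trans d≤ (lower≤ 𝓑J 𝓑L)

        C : Cut I
        C = record
          { D          = D
          ; E          = E
          ; D-nonempty = lower J₀ , J₀ , 𝓑J₀ , ≤-refl
          ; E-nonempty = upper J₀ , J₀ , 𝓑J₀ , ≤-refl
          ; cover      = cover
          ; D<E        = λ {d} {e} Dd Ee →
              [ id , (λ e≤d → contradiction e≤d (D≰E Dd Ee)) ]′ (total d e) ,
              λ d≈e → D≰E Dd Ee (reflexive (Eq.sym d≈e))
          }

        -- A maximum of `D` would bound all lower endpoints while staying below all upper ones, and
        -- so lie in the intersection.
        D-noMaximum : NoMaximum (lowerPart C)
        D-noMaximum (d , Dd) = by-contradiction λ d-max → empty d λ {J} 𝓑J →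
          by-contradiction (λ ¬≤ → d-max ((lower J , J , 𝓑J , ≤-refl) , ¬≤)) ,
          [ id , (λ ≤d → contradiction ≤d (D≰E Dd (J , 𝓑J , ≤-refl))) ]′ (total d (upper J))

        E-noMinimum : NoMaximum (upperPart C)
        E-noMinimum (e , Ee) = by-contradiction λ e-min → empty e λ {J} 𝓑J →
          [ id , (λ e≤ → contradiction e≤ (D≰E (J , 𝓑J , ≤-refl) Ee)) ]′ (total (lower J) e) ,
          by-contradiction (λ ¬≤ → e-min ((upper J , J , 𝓑J , ≤-refl) , ¬≤))

        nonprincipal : ¬ Principal C
        nonprincipal (inj₁ (d , d-max)) = proj₂ (D-noMaximum d) (d-max (proj₁ (D-noMaximum d)))
        nonprincipal (inj₂ (e , e-min)) = proj₂ (E-noMinimum e) (e-min (proj₁ (E-noMinimum e)))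

        absurd : ⊥
        absurd = asymmetric⇒¬equicofinal C (dcomplete C nonprincipal)
          ( nested⇒≼ R (λ (J , 𝓑J , p , q) (K , 𝓑K , p′ , q′) → compare 𝓑J 𝓑K p q p′ q′)
              reachD reachE E-noMinimum
          , nested⇒≼ (λ e d → R d e)
              (λ (J , 𝓑J , p , q) (K , 𝓑K , p′ , q′) → swap (compare 𝓑J 𝓑K p q p′ q′))
              (λ e → case reachE e of λ where (x , y , r , h) → y , x , r , h)
              (λ d → case reachD d of λ where (x , y , r , h) → y , x , r , h)
              D-noMaximum)
          where
          R : ∃ D → ∃ E → Set ℓ
          R (d , _) (e , _) = ∃[ J ] 𝓑 J × lower J ≡ d × upper J ≡ e

          compare : ∀ {J K x y x′ y′} → 𝓑 J → 𝓑 K →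
                    lower J ≡ x → upper J ≡ y → lower K ≡ x′ → upper K ≡ y′ →
                    x ≤ x′ × y′ ≤ y ⊎ x′ ≤ x × y ≤ y′
          compare 𝓑J 𝓑K ≡.refl ≡.refl ≡.refl ≡.refl = nested 𝓑J 𝓑K

          swap : ∀ {P Q P′ Q′ : Set ℓ} → P × Q ⊎ P′ × Q′ → Q × P ⊎ Q′ × P′
          swap (inj₁ (p , q)) = inj₁ (q , p)
          swap (inj₂ (p , q)) = inj₂ (q , p)

          reachD : ∀ (d : ∃ D) → ∃[ d′ ] ∃[ e′ ] R d′ e′ × proj₁ d ≤ proj₁ d′
          reachD (d , J , 𝓑J , d≤) = (lower J , J , 𝓑J , ≤-refl) , (upper J , J , 𝓑J , ≤-refl) ,
            (J , 𝓑J , ≡.refl , ≡.refl) , d≤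

          reachE : ∀ (e : ∃ E) → ∃[ d′ ] ∃[ e′ ] R d′ e′ × proj₁ e′ ≤ proj₁ e
          reachE (e , J , 𝓑J , ≤e) = (lower J , J , 𝓑J , ≤-refl) , (upper J , J , 𝓑J , ≤-refl) ,
            (J , 𝓑J , ≡.refl , ≡.refl) , ≤e

  module _ (I : LinearOrder ℓ) (C : Cut I) where
    open TotalOrder I renaming (trans to ≤-trans; refl to ≤-refl)
    open Cut C
    open Ordinals ℓ

    private
      A B : LinearOrder ℓ
      A = lowerPart C
      B = upperPart C

      -- Reindexing along the shorter scale would give a cofinal sequence of `A` below its minimal
      -- length. Applied both ways, this makes the two lengths equal.
      shorter : {A B : LinearOrder ℓ} (s : Scale A) (t : Scale B) → ∣ A ∣ → A ≼ B →
                ¬ Scale.length t ≺ Scale.length s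
      shorter {A} {B} s t x₀ A≼B t≺s = Scale.minimal s t≺s
        (reindex x₀ (scale⇒isCofinality s) (A≼B _ _ (scale⇒isCofinality s) (scale⇒isCofinality t))
          (λ β → β ≺ Scale.length t) (λ β k → Scale.seq t β B.≈ proj₁ k)
          (λ p q → B.Eq.trans (B.Eq.sym p) q) (λ k → unresize (proj₂ k)))
        where module B = TotalOrder B

    -- Equal cofinalities on both sides of a cut yield a nested sequence of
    -- intervals closing in on it.
    sphericallyComplete⇒principal : SphericallyComplete I → Equicofinal A B → Principal C
    sphericallyComplete⇒principal complete (A≼B , B≼A) = principal
      where
      s : Scale A
      s = scale A D-nonempty
      t : Scale B
      t = scale B E-nonempty
      module s = Scale s
      module t = Scale t

      equal-length : s.length ≡ t.length
      equal-length with ≺-total s.length t.length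
      ... | inj₁ eq         = eq
      ... | inj₂ (inj₁ s≺t) = contradiction s≺t (shorter t s E-nonempty B≼A)
      ... | inj₂ (inj₂ t≺s) = contradiction t≺s (shorter s t D-nonempty A≼B)

      d : Ordinal → ∣ A ∣
      d = proj₁ (monotone-scale s)
      e : Ordinal → ∣ B ∣
      e = proj₁ (monotone-scale t)

      J : Ordinal → ClosedInterval I
      J β = record
        { lower       = proj₁ (d β)
        ; upper       = proj₁ (e β)
        ; lower≤upper = proj₁ (D<E (proj₂ (d β)) (proj₂ (e β)))
        }

      𝓑 : Pred (ClosedInterval I) ℓ
      𝓑 K = Resize ℓ (∃[ β ] β ≺ s.length × K ≡ J β)

      shrink : ∀ {β γ} → γ ≺ β → β ≺ s.length → ∀ {x} → points I (J β) x → points I (J γ) x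
      shrink γ≺β β≺ (l , u) =
        ≤-trans (proj₂ (proj₂ (monotone-scale s)) γ≺β β≺) l ,
        ≤-trans u (proj₂ (proj₂ (monotone-scale t)) γ≺β (subst (_ ≺_) equal-length β≺))

      chain : IsChain I 𝓑
      chain 𝓑J 𝓑K with unresize 𝓑J | unresize 𝓑K
      ... | β , β≺ , ≡.refl | γ , γ≺ , ≡.refl with ≺-total β γ
      ... | inj₁ ≡.refl       = inj₁ id
      ... | inj₂ (inj₁ β≺γ) = inj₂ (shrink β≺γ γ≺)
      ... | inj₂ (inj₂ γ≺β) = inj₁ (shrink γ≺β β≺)

      member : ∀ {β} → β ≺ s.length → 𝓑 (J β)
      member β≺ = resize (_ , β≺ , ≡.refl)

      principal : Principal C
      principal with complete 𝓑 (_ , member (proj₁ (proj₂ (s.cofinal D-nonempty)))) chain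
      -- The common point bounds both sequences, so it is the extreme element of whichever side
      -- contains it.
      ... | x , x∈ with cover x
      ... | inj₁ Dx = inj₁ ((x , Dx) , λ y → case s.cofinal y of λ where
        (β , β≺ , y≤) → ≤-trans y≤
          (≤-trans (proj₁ (proj₂ (monotone-scale s)) β≺) (proj₁ (x∈ (member β≺)))))
      ... | inj₂ Ex = inj₂ ((x , Ex) , λ y → case t.cofinal y of λ where
        (β , β≺ , ≤y) → ≤-trans
          (≤-trans (proj₂ (x∈ (member (subst (β ≺_) (≡.sym equal-length) β≺))))
                   (proj₁ (proj₂ (monotone-scale t)) β≺)) ≤y)

  sphericallyComplete⇒symmetricallyDComplete : (I : LinearOrder ℓ) →
    SphericallyComplete I → SymmetricallyDComplete I
  sphericallyComplete⇒symmetricallyDComplete I complete C nonprincipal =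
    ¬equicofinal⇒asymmetric C λ equi →
      nonprincipal (sphericallyComplete⇒principal I C complete equi)

open OrderedAbelianGroup using (Carrier; totalOrder)

-- Arithmetic in ordered abelian groups

module OrderedGroupProperties (G : OrderedAbelianGroup ℓ) where
  open OrderedGroupLemmas G hiding (Carrier; totalOrder)

  private module R = ≤-Reasoning poset

  +-cancelʳ-≤ : ∀ {x y} z → x + z ≤ y + z → x ≤ y
  +-cancelʳ-≤ {x} {y} z x+z≤y+z = begin
    x           ≈⟨ x+y-y x z ⟨
    (x + z) - z ≤⟨ +-monoˡ-≤ (- z) x+z≤y+z ⟩
    (y + z) - z ≈⟨ x+y-y y z ⟩
    y           ∎
    where open R

  ≤-⇒+≤ : ∀ {x y z} → x ≤ z - y → x + y ≤ z
  ≤-⇒+≤ {x} {y} {z} x≤z-y = ≤-trans (+-monoˡ-≤ y x≤z-y) (≤-reflexive (x-y+y z y))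

  +≤⇒≤- : ∀ {x y z} → x + y ≤ z → x ≤ z - y
  +≤⇒≤- {x} {y} {z} x+y≤z = ≤-trans (≤-reflexive (sym (x+y-y x y))) (+-monoˡ-≤ (- y) x+y≤z)

  ·-monoʳ-≤ : ∀ n {x y} → x ≤ y → n · x ≤ n · y
  ·-monoʳ-≤ zero    x≤y = ≤-refl
  ·-monoʳ-≤ (suc n) x≤y = +-mono-≤ x≤y (·-monoʳ-≤ n x≤y)

  ·-zeroʳ : ∀ n → n · 0# ≈ 0#
  ·-zeroʳ zero    = refl
  ·-zeroʳ (suc n) = trans (+-identityˡ _) (·-zeroʳ n)

  ·-monoˡ-≤ : ∀ {x} → 0# ≤ x → ∀ {m n} → m ℕ.≤ n → m · x ≤ n · x
  ·-monoˡ-≤ {x} 0≤x {m} {n} m≤n =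
    subst (λ k → m · x ≤ k · x) (ℕ.m+[n∸m]≡n m≤n) (·-monoʳ 0≤x m (n ℕ.∸ m))

  coinitial⇒cofinal : ∃ (λ (s : ℕ → Carrier G) → ∀ x → ∃[ n ] s n ≤ x) →
                      ∃ λ (s : ℕ → Carrier G) → ∀ x → ∃[ n ] x ≤ s n
  coinitial⇒cofinal (s , reaches) = -_ ∘ s , λ x → case reaches (- x) of λ where
    (n , s≤-x) → n , ≤-trans (≤-reflexive (sym (-‿involutive x))) (-‿anti-≤ s≤-x)

-- Discretely ordered groups: the copy of ℤ and division

module DiscretelyOrdered (em : ∀ a → ExcludedMiddle a) (ext : ∀ a b → Extensionality a b)
                         (G : OrderedAbelianGroup ℓ) {e : Carrier G}
                         (e-least : IsLeastPositive G e) where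
  open OrderedGroupLemmas G hiding (Carrier; totalOrder)
  open OrderedGroupProperties G
  open AbelianGroup abelianGroup using (reflexive)
  open Classical em ext
  open CofinalityTheory em ext
  open OrderTheory em ext
  open IsLeastPositive e-least

  private
    module R = ≤-Reasoning poset

    I : LinearOrder ℓ
    I = totalOrder G

  0≤e : 0# ≤ e
  0≤e = proj₁ positive

  Z : ConvexSubgroup G
  Z = generated G e 0≤e

  G/Z : OrderedAbelianGroup ℓ
  G/Z = quotientByℤ G e-least

  module Z = ConvexSubgroup Z
  open OrderedAbelianGroup G/Z using () renaming (_≤_ to _≤ᶻ_; _≈_ to _≈ᶻ_; _·_ to _·ᶻ_)
  private module Q = TotalOrder (totalOrder G/Z)

  x+e≰x : ∀ {x} → ¬ x + e ≤ x
  x+e≰x {x} x+e≤x = proj₂ positive (antisym 0≤e (+-cancelʳ-≤ x (begin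
    e + x  ≈⟨ +-comm e x ⟩
    x + e  ≤⟨ x+e≤x ⟩
    x      ≈⟨ +-identityˡ x ⟨
    0# + x ∎)))
    where open R

  ≰⇒+e≤ : ∀ {x y} → ¬ y ≤ x → x + e ≤ y
  ≰⇒+e≤ {x} {y} y≰x = ≤-trans (≤-reflexive (+-comm x e)) (≤-⇒+≤ (least 0<y-x))
    where
    x≤y : x ≤ y
    x≤y = [ id , (λ y≤x → contradiction y≤x y≰x) ]′ (total x y)
    0<y-x : 0# < y - x
    0<y-x = +≤⇒≤- (≤-trans (≤-reflexive (+-identityˡ x)) x≤y) ,
      λ 0≈y-x → y≰x (begin
        y           ≈⟨ x-y+y y x ⟨
        (y - x) + x ≈⟨ +-congʳ 0≈y-x ⟨
        0# + x      ≈⟨ +-identityˡ x ⟩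
        x           ∎)
      where open R

  φ : ℤ → Carrier G
  φ (+ n)    = n · e
  φ -[1+ n ] = - (suc n · e)

  φ-⊖ : ∀ m n → φ (m ℤ.⊖ n) ≈ m · e - n · e
  φ-⊖ zero    zero    = sym (-‿inverseʳ 0#)
  φ-⊖ (suc m) zero    = sym (trans (+-congˡ -0#≈0#) (+-identityʳ _))
  φ-⊖ zero    (suc n) = sym (+-identityˡ _)
  φ-⊖ (suc m) (suc n) rewrite ℤ.[1+m]⊖[1+n]≡m⊖n m n = begin-equality
    φ (m ℤ.⊖ n)                     ≈⟨ φ-⊖ m n ⟩
    m · e - n · e                   ≈⟨ +-identityˡ _ ⟨
    0# + (m · e - n · e)            ≈⟨ +-congʳ (-‿inverseʳ e) ⟨
    (e - e) + (m · e - n · e)       ≈⟨ interchange e (- e) (m · e) (- (n · e)) ⟩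
    suc m · e + (- e - n · e)       ≈⟨ +-congˡ (-‿+-comm e (n · e)) ⟩
    suc m · e - suc n · e           ∎
    where open R

  φ-+ : ∀ i j → φ (i ℤ.+ j) ≈ φ i + φ j
  φ-+ (+ m)    (+ n)    = ×-homo-+ e m n
  φ-+ (+ m)    -[1+ n ] = φ-⊖ m (suc n)
  φ-+ -[1+ m ] (+ n)    = trans (φ-⊖ n (suc m)) (+-comm _ _)
  φ-+ -[1+ m ] -[1+ n ] = trans
    (-‿cong (trans (reflexive (cong (λ k → suc k · e) (≡.sym (ℕ.+-suc m n))))
      (×-homo-+ e (suc m) (suc n)))) (sym (-‿+-comm _ _))

  φ-neg : ∀ i → φ (ℤ.- i) ≈ - φ i
  φ-neg (+ zero)  = sym -0#≈0#
  φ-neg (+ suc n) = refl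
  φ-neg -[1+ n ]  = sym (-‿involutive _)

  φ-mono : ∀ {i j} → i ℤ.≤ j → φ i ≤ φ j
  φ-mono (ℤ.-≤- n≤m) = -‿anti-≤ (·-monoˡ-≤ 0≤e (ℕ.s≤s n≤m))
  φ-mono (ℤ.-≤+ {m} {n}) = begin
    - (suc m · e) ≤⟨ -‿anti-≤ (·-nonneg 0≤e (suc m)) ⟩
    - 0#          ≈⟨ -0#≈0# ⟩
    0#            ≤⟨ ·-nonneg 0≤e n ⟩
    n · e         ∎
    where open R
  φ-mono (ℤ.+≤+ m≤n) = ·-monoˡ-≤ 0≤e m≤n

  φ-strict : ∀ {i j} → i ℤ.< j → ¬ φ j ≤ φ i
  φ-strict {i} {j} i<j φj≤φi = x+e≰x (begin
    φ i + e          ≈⟨ +-congˡ (+-identityʳ e) ⟨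
    φ i + 1 · e      ≈⟨ +-comm _ _ ⟩
    φ (+ 1) + φ i    ≈⟨ φ-+ (+ 1) i ⟨
    φ (ℤ.suc i)      ≤⟨ φ-mono (ℤ.i<j⇒suc[i]≤j i<j) ⟩
    φ j              ≤⟨ φj≤φi ⟩
    φ i              ∎)
    where open R

  φ-cancel : ∀ {i j} → φ i ≤ φ j → i ℤ.≤ j
  φ-cancel {i} {j} φi≤φj with i ℤ.≤? j
  ... | yes i≤j = i≤j
  ... | no i≰j  = contradiction φi≤φj (φ-strict (ℤ.≰⇒> i≰j))

  φ-injective : ∀ {i j} → φ i ≈ φ j → i ≡ j
  φ-injective φi≈φj =
    ℤ.≤-antisym (φ-cancel (≤-reflexive φi≈φj)) (φ-cancel (≤-reflexive (sym φi≈φj)))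

  -- By discreteness an element not below `n · e` is at least `n · e + e`, which the upper bound
  -- turns into an equality.
  bounded⇒multiple : ∀ n {x} → 0# ≤ x → x ≤ n · e → ∃[ k ] k · e ≈ x
  bounded⇒multiple zero    0≤x x≤0 = 0 , antisym 0≤x x≤0
  bounded⇒multiple (suc n) {x} 0≤x x≤ with dec (x ≤ n · e)
  ... | yes x≤ne = bounded⇒multiple n 0≤x x≤ne
  ... | no x≰ne  = suc n , antisym (≤-trans (≤-reflexive (+-comm e _)) (≰⇒+e≤ x≰ne)) x≤

  Z-φ : ∀ i → Z.Member (φ i)
  Z-φ (+ n)    = n ,
    ≤-trans (-‿anti-≤ (·-nonneg 0≤e n)) (≤-trans (≤-reflexive -0#≈0#) (·-nonneg 0≤e n)) , ≤-refl
  Z-φ -[1+ n ] = Z.-‿closed (Z-φ (+ suc n))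

  Z⊆φ : ∀ {x} → Z.Member x → ∃[ i ] φ i ≈ x
  Z⊆φ {x} (n , -ne≤x , x≤ne) with total 0# x
  ... | inj₁ 0≤x with bounded⇒multiple n 0≤x x≤ne
  ... | k , ke≈x = + k , ke≈x
  Z⊆φ {x} (n , -ne≤x , x≤ne) | inj₂ x≤0
    with bounded⇒multiple n (≤-trans (≤-reflexive (sym -0#≈0#)) (-‿anti-≤ x≤0))
           (≤-trans (-‿anti-≤ -ne≤x) (≤-reflexive (-‿involutive _)))
  ... | k , ke≈-x = ℤ.- (+ k) , trans (φ-neg (+ k)) (trans (-‿cong ke≈-x) (-‿involutive x))

  Z≅ℤ : IsomorphicToℤ G Z
  Z≅ℤ = record
    { φ                   = φ
    ; isGroupHomomorphism = record
      { isMonoidHomomorphism = record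
        { isMagmaHomomorphism = record
          { isRelHomomorphism = record { cong = λ { ≡.refl → refl } }
          ; homo              = φ-+
          }
        ; ε-homo = refl
        }
      ; ⁻¹-homo = φ-neg
      }
    ; isOrderMonomorphism = record
      { isOrderHomomorphism = record { cong = λ { ≡.refl → refl } ; mono = φ-mono }
      ; injective           = φ-injective
      ; cancel              = φ-cancel
      }
    ; image = λ x → mk⇔ Z⊆φ λ (i , φi≈x) → Z.resp φi≈x (Z-φ i)
    }

  -- Division with remainder by suc n. In the inductive step, d is sought in the chain of
  -- intervals [d, x - suc n · d], where suc (suc n) · d ≤ x. A common point y that is
  -- not itself admissible bounds suc n · d by x - y for all admissible d,
  -- so dividing x - y by suc n yields the largest admissible d.
  quotient-exists : SphericallyComplete I → ∀ n x → ∃[ d ] suc n · d ≤ x × ¬ suc n · (d + e) ≤ x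
  quotient-exists complete zero x =
    x , ≤-reflexive (+-identityʳ x) ,
    λ x+e≤x → x+e≰x (≤-trans (≤-reflexive (sym (+-identityʳ (x + e)))) x+e≤x)
  quotient-exists complete (suc n) x = from-point (complete 𝓑 nonempty chain)
    where
    J : ∀ d → suc (suc n) · d ≤ x → ClosedInterval I
    J d d≤ = record { lower = d ; upper = x - suc n · d ; lower≤upper = +≤⇒≤- d≤ }

    𝓑 : Pred (ClosedInterval I) ℓ
    𝓑 K = ∃[ d ] ∃[ d≤ ] K ≡ J d d≤

    nonempty : ∃ 𝓑
    nonempty with total 0# x
    -- For nonnegative `x` the element `0#` is admissible; otherwise `x` is, as further copies of a
    -- nonpositive `x` only lower the sum.
    ... | inj₁ 0≤x = J 0# 0· , 0# , 0· , ≡.refl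
      where 0· = ≤-trans (≤-reflexive (·-zeroʳ (suc (suc n)))) 0≤x
    ... | inj₂ x≤0 = J x x· , x , x· , ≡.refl
      where
      x· : x + suc n · x ≤ x
      x· = begin
        x + suc n · x  ≤⟨ +-mono-≤ ≤-refl (·-monoʳ-≤ (suc n) x≤0) ⟩
        x + suc n · 0# ≈⟨ +-congˡ (·-zeroʳ (suc n)) ⟩
        x + 0#         ≈⟨ +-identityʳ x ⟩
        x              ∎
        where open R

    shrink : ∀ {d d′} (d≤ : suc (suc n) · d ≤ x) (d′≤ : suc (suc n) · d′ ≤ x) → d ≤ d′ →
             ∀ {y} → points I (J d′ d′≤) y → points I (J d d≤) y
    shrink _ _ d≤d′ (l , u) = ≤-trans d≤d′ l ,
      ≤-trans u (+-mono-≤ ≤-refl (-‿anti-≤ (·-monoʳ-≤ (suc n) d≤d′)))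

    chain : IsChain I 𝓑
    chain (d , d≤ , ≡.refl) (d′ , d′≤ , ≡.refl) with total d d′
    ... | inj₁ d≤d′ = inj₂ (shrink d≤ d′≤ d≤d′)
    ... | inj₂ d′≤d = inj₁ (shrink d′≤ d≤ d′≤d)

    from-point : ∃[ y ] (∀ {K} → 𝓑 K → points I K y) →
                 ∃[ d ] suc (suc n) · d ≤ x × ¬ suc (suc n) · (d + e) ≤ x
    from-point (y , y∈) with dec (suc (suc n) · y ≤ x)
    -- Each admissible element is the lower end of an interval of the chain, hence at most `y`; an
    -- admissible `y` is therefore the largest.
    ... | yes y≤ = y , y≤ , λ y+e≤ → x+e≰x (proj₁ (y∈ (_ , y+e≤ , ≡.refl)))
    ... | no y≰ with quotient-exists complete n (x - y)
    ... | d , d≤ , d+e≰ = d , admissible , λ d+e≤ → d+e≰ (bound d+e≤)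
      where
      bound : ∀ {d} → suc (suc n) · d ≤ x → suc n · d ≤ x - y
      bound {d} d≤ = +≤⇒≤-
        (≤-trans (≤-reflexive (+-comm _ _)) (≤-⇒+≤ (proj₂ (y∈ (d , d≤ , ≡.refl)))))

      -- If `y ≤ d`, then `suc n · y` is at most `x - y`, which would make `y` admissible.
      d≤y : d ≤ y
      d≤y with total d y
      ... | inj₁ d≤y = d≤y
      ... | inj₂ y≤d = contradiction
        (≤-trans (≤-reflexive (+-comm _ _)) (≤-⇒+≤ (≤-trans (·-monoʳ-≤ (suc n) y≤d) d≤))) y≰

      admissible : d + suc n · d ≤ x
      admissible = begin
        d + suc n · d ≤⟨ +-mono-≤ d≤y d≤ ⟩
        y + (x - y)   ≈⟨ +-comm y (x - y) ⟩
        (x - y) + y   ≈⟨ x-y+y x y ⟩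
        x             ∎
        where open R

  -- The remainder lies between `0#` and `suc n · e`, so it vanishes modulo `Z`.
  divisible : SphericallyComplete I → Divisible G/Z
  divisible complete (suc n) x with quotient-exists complete n x
  ... | d , d≤x , d+e≰x = d , subst (_≈ᶻ x) (≡.sym (·ᶻ≡· (suc n))) (suc n , lower , upper)
    where
    ·ᶻ≡· : ∀ m → m ·ᶻ d ≡ m · d
    ·ᶻ≡· zero    = ≡.refl
    ·ᶻ≡· (suc m) = cong (λ y → d + y) (·ᶻ≡· m)

    upper : suc n · d - x ≤ suc n · e
    upper = ≤-trans (≤+⇒-≤ (≤-trans d≤x (≤-reflexive (sym (+-identityʳ x))))) (·-nonneg 0≤e (suc n))

    ·-distrib-+ : ∀ m → m · (d + e) ≈ m · d + m · e
    ·-distrib-+ zero    = sym (+-identityˡ 0#)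
    ·-distrib-+ (suc m) = trans (+-congˡ (·-distrib-+ m)) (interchange d e (m · d) (m · e))

    x≤ : x ≤ suc n · d + suc n · e
    x≤ = ≤-trans ([ (λ p → contradiction p d+e≰x) , id ]′ (total _ _))
      (≤-reflexive (·-distrib-+ (suc n)))

    lower : - (suc n · e) ≤ suc n · d - x
    lower = ≤-trans (-‿anti-≤ (≤+⇒-≤ x≤)) (≤-reflexive (-‿flip x (suc n · d)))

  isℤGroup : SphericallyComplete I → IsℤGroup G
  isℤGroup complete = Z , Z≅ℤ , divisible complete

  -- Cuts of the group and cuts of its quotient

  ≤⇒≤ᶻ : ∀ {x y} → x ≤ y → x ≤ᶻ y
  ≤⇒≤ᶻ {x} {y} x≤y = 0# , Z.0#-member , ≤-trans x≤y (≤-reflexive (sym (+-identityʳ y)))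

  ≤ᶻ⇒≤+ : ∀ {x y} → x ≤ᶻ y → ∃[ n ] x ≤ y + n · e
  ≤ᶻ⇒≤+ (h , (n , _ , h≤ne) , x≤y+h) = n , ≤-trans x≤y+h (+-mono-≤ ≤-refl h≤ne)

  x+e≈ᶻx : ∀ {x} → x + e ≈ᶻ x
  x+e≈ᶻx {x} = Z.resp (sym (trans (+-congʳ (+-comm x e)) (x+y-y e x)))
    (Z.resp (+-identityʳ e) (Z-φ (+ 1)))

  coarsening : Coarsening I (totalOrder G/Z)
  coarsening = record
    { ι       = id
    ; π       = id
    ; mono    = ≤⇒≤ᶻ
    ; section = λ _ → Q.refl
    ; shift   = λ y n → y + n · e
    ; absorb  = ≤ᶻ⇒≤+
    }

  -- The two closure conditions say that the cut splits no coset of `Z`: each coset meeting a side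
  -- lies in it, with a countable sequence running to its end.
  module ShiftInvariant (C : Cut I)
                        (D-shift : ∀ {x} → Cut.D C x → Cut.D C (x + e))
                        (E-shift : ∀ {x} → Cut.E C x → Cut.E C (x - e)) where
    open Cut C

    E≰D : ∀ {d x} → D d → E x → ¬ x ≤ d
    E≰D Dd Ex x≤d = proj₂ (D<E Dd Ex) (antisym (proj₁ (D<E Dd Ex)) x≤d)

    D-down : ∀ {x y} → x ≤ y → D y → D x
    D-down {x} x≤y Dy = [ id , (λ Ex → contradiction x≤y (E≰D Dy Ex)) ]′ (cover x)

    E-up : ∀ {x y} → x ≤ y → E x → E y
    E-up {y = y} x≤y Ex = [ (λ Dy → contradiction x≤y (E≰D Dy Ex)) , id ]′ (cover y)

    D-shift-· : ∀ {x} n → D x → D (x + n · e)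
    D-shift-· zero    Dx = D-down (≤-reflexive (+-identityʳ _)) Dx
    D-shift-· (suc n) Dx = D-down
      (≤-reflexive (sym (+-assoc _ e (n · e)))) (D-shift-· n (D-shift Dx))

    E-shift-· : ∀ {x} n → E x → E (x - n · e)
    E-shift-· zero    Ex = E-up (≤-reflexive (sym (trans (+-congˡ -0#≈0#) (+-identityʳ _)))) Ex
    E-shift-· (suc n) Ex = E-up
      (≤-reflexive (trans (+-assoc _ (- e) _) (+-congˡ (-‿+-comm e (n · e)))))
      (E-shift-· n (E-shift Ex))

    D-coarsening : Coarsening (lowerPart C) (restrict (totalOrder G/Z) D)
    D-coarsening = record
      { ι       = id
      ; π       = id
      ; mono    = ≤⇒≤ᶻ
      ; section = λ _ → Q.refl
        ; shift   = λ (y , Dy) n → y + n · e , D-shift-· n Dy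
      ; absorb  = ≤ᶻ⇒≤+
      }

    E-coarsening : Coarsening (upperPart C) (Flip.totalOrder (restrict (totalOrder G/Z) E))
    E-coarsening = record
      { ι       = id
      ; π       = id
      ; mono    = ≤⇒≤ᶻ
      ; section = λ _ → Q.refl
        ; shift   = λ (y , Ey) n → y - n · e , E-shift-· n Ey
      ; absorb  = λ y≤ᶻx → case ≤ᶻ⇒≤+ y≤ᶻx of λ where
          (n , y≤x+ne) → n , ≤+⇒-≤ (≤-trans y≤x+ne (≤-reflexive (+-comm _ _)))
      }

    D-noMaximum : NoMaximum (lowerPart C)
    D-noMaximum (d , Dd) = (d + e , D-shift Dd) , x+e≰x

    E-noMinimum : NoMaximum (upperPart C)
    E-noMinimum (x , Ex) = (x - e , E-shift Ex) , λ x≤x-e → x+e≰x (≤-⇒+≤ x≤x-e)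

  liftCut : Cut (totalOrder G/Z) → Cut I
  liftCut C = record
    { D          = D
    ; E          = E
    ; D-nonempty = D-nonempty
    ; E-nonempty = E-nonempty
    ; cover      = cover
    ; D<E        = λ {d} {x} Dd Ex →
        [ id , (λ x≤d → contradiction x≤d (D≰E Dd Ex)) ]′ (total d x) ,
        λ d≈x → D≰E Dd Ex (≤-reflexive (sym d≈x))
    }
    where
    open Cut C
    D≰E : ∀ {d x} → D d → E x → ¬ x ≤ d
    D≰E Dd Ex x≤d = proj₂ (D<E Dd Ex) (Q.antisym (proj₁ (D<E Dd Ex)) (≤⇒≤ᶻ x≤d))

  module Lifted (C : Cut (totalOrder G/Z)) where
    open Cut C

    -- An element and its translate are equal in the quotient, so the strict inequality between the
    -- sides keeps them together.
    D-shift : ∀ {x} → D x → D (x + e)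
    D-shift {x} Dx =
      [ id , (λ Ex+e → contradiction (Q.Eq.sym x+e≈ᶻx) (proj₂ (D<E Dx Ex+e))) ]′ (cover (x + e))

    E-shift : ∀ {x} → E x → E (x - e)
    E-shift {x} Ex =
      [ (λ Dx-e → contradiction x-e≈ᶻx (proj₂ (D<E Dx-e Ex))) , id ]′ (cover (x - e))
      where
      x-e≈ᶻx : x - e ≈ᶻ x
      x-e≈ᶻx = Q.Eq.trans (Q.Eq.sym x+e≈ᶻx)
        (Z.resp (sym (trans (+-congʳ (x-y+y x e)) (-‿inverseʳ x))) Z.0#-member)

  -- The lifted cut has no extreme elements, so two countably cofinal sides in the quotient would
  -- both have cofinality ω in `G`, against asymmetry. With that case excluded, equal cofinalities
  -- in the quotient would lift to `G` as well.
  symmetricallyDComplete⇒stronglySymmetricallyComplete :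
    SymmetricallyDComplete I → StronglySymmetricallyComplete (totalOrder G/Z)
  symmetricallyDComplete⇒stronglySymmetricallyComplete dcomplete C = ⇒stronglyAsymmetric C
    (λ equi → ¬equi
      (equicofinal-fine D-coarsening E-coarsening D-nonempty E-nonempty ¬countable equi))
    ¬countable
    where
    open Cut C
    open Lifted C
    open ShiftInvariant (liftCut C) D-shift E-shift

    nonprincipal : ¬ Principal (liftCut C)
    nonprincipal (inj₁ ((d , Dd) , d-max)) =
      proj₂ (D-noMaximum (d , Dd)) (d-max (d + e , D-shift Dd))
    nonprincipal (inj₂ ((x , Ex) , x-min)) =
      proj₂ (E-noMinimum (x , Ex)) (x-min (x - e , E-shift Ex))

    ¬equi : ¬ Equicofinal (lowerPart (liftCut C)) (upperPart (liftCut C))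
    ¬equi = asymmetric⇒¬equicofinal (liftCut C) (dcomplete (liftCut C) nonprincipal)

    ¬countable : ¬ (CountablyCofinal (lowerPart C) × CountablyCofinal (upperPart C))
    ¬countable cc = ¬equi
      (countable-fine D-coarsening E-coarsening D-nonempty E-nonempty D-noMaximum E-noMinimum cc)

  stronglySymmetricallyComplete⇒symmetricallyDComplete :
    StronglySymmetricallyComplete (totalOrder G/Z) → SymmetricallyDComplete I
  stronglySymmetricallyComplete⇒symmetricallyDComplete scomplete C nonprincipal =
    ¬equicofinal⇒asymmetric C λ equi →
      asymmetric⇒¬equicofinal C/Z (stronglyAsymmetric⇒asymmetric C/Z strong)
        (equicofinal-coarse D-coarsening E-coarsening D-nonempty E-nonempty
          (stronglyAsymmetric⇒¬countable C/Z strong) equi)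
    where
    open Cut C

    D-shift : ∀ {x} → D x → D (x + e)
    D-shift {x} Dx with cover (x + e)
    ... | inj₁ Dx+e = Dx+e
    -- By discreteness, an element of `D` strictly above `x` would be at least `x + e`; hence `x`
    -- would be the maximum of `D`.
    ... | inj₂ Ex+e = contradiction (inj₁ ((x , Dx) , λ (y , Dy) → by-contradiction λ y≰x →
      proj₂ (D<E Dy Ex+e) (antisym (proj₁ (D<E Dy Ex+e)) (≰⇒+e≤ y≰x)))) nonprincipal

    E-shift : ∀ {x} → E x → E (x - e)
    E-shift {x} Ex with cover (x - e)
    ... | inj₂ Ex-e = Ex-e
    ... | inj₁ Dx-e = contradiction (inj₂ ((x , Ex) , λ (y , Ey) → by-contradiction λ x≰y →
      proj₂ (D<E Dx-e Ey) (antisym (proj₁ (D<E Dx-e Ey)) (+≤⇒≤- (≰⇒+e≤ x≰y))))) nonprincipal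

    open ShiftInvariant C D-shift E-shift

    C/Z : Cut (totalOrder G/Z)
    C/Z = record
      { D          = D
      ; E          = E
      ; D-nonempty = D-nonempty
      ; E-nonempty = E-nonempty
      ; cover      = cover
      ; D<E        = λ {d} {x} Dd Ex → ≤⇒≤ᶻ (proj₁ (D<E Dd Ex)) , λ d≈ᶻx →
          -- Equality modulo `Z` would put `x` below some `d + n · e`, which still belongs to `D`.
          case ≤ᶻ⇒≤+ (Q.reflexive (Q.Eq.sym d≈ᶻx)) of λ where
            (n , x≤d+ne) → proj₂ (D<E (D-shift-· n Dd) Ex)
              (antisym (proj₁ (D<E (D-shift-· n Dd) Ex)) x≤d+ne)
      }

    strong : StronglyAsymmetric C/Z
    strong = scomplete C/Z

  extremely⇔ : ExtremelySymmetricallyDComplete I ⇔ ExtremelySymmetricallyComplete (totalOrder G/Z)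
  extremely⇔ = mk⇔
    (λ (dcomplete , unc) →
      let ¬cc = λ cc → uncountableCofinality⇒ I unc (countable⇐ cc) in
      symmetricallyDComplete⇒stronglySymmetricallyComplete dcomplete
      , ⇒uncountableCofinality (Flip.totalOrder (totalOrder G/Z)) 0#
          -- Negation reverses the order of the quotient, so its coinitiality is uncountable as soon
          -- as its cofinality is.
          (λ cc → ¬cc (OrderedGroupProperties.coinitial⇒cofinal G/Z cc))
      , ⇒uncountableCofinality (totalOrder G/Z) 0# ¬cc)
    (λ (scomplete , _ , unc) →
      stronglySymmetricallyComplete⇒symmetricallyDComplete scomplete
      , ⇒uncountableCofinality I 0#
          λ cc → uncountableCofinality⇒ (totalOrder G/Z) unc (countable⇒ cc))
    where open Coarsening coarsening

theorem9 : (∀ a → ExcludedMiddle a) →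
    (∀ a b → Extensionality a b) →
    ∀ {ℓ} (G : OrderedAbelianGroup ℓ) {e : Carrier G} (e-least : IsLeastPositive G e) →
    (SymmetricallyDComplete (totalOrder G) ⇔ SphericallyComplete (totalOrder G))
    × (SphericallyComplete (totalOrder G) ⇔
    (IsℤGroup G × StronglySymmetricallyComplete (totalOrder (quotientByℤ G e-least))))
    × (ExtremelySymmetricallyDComplete (totalOrder G) ⇔
    ExtremelySymmetricallyComplete (totalOrder (quotientByℤ G e-least)))
theorem9 em ext G e-least =
    mk⇔ a⇒b b⇒a
  , mk⇔ (λ complete →
          isℤGroup complete ,
          symmetricallyDComplete⇒stronglySymmetricallyComplete (b⇒a complete))
        (λ (_ , scomplete) → a⇒b (stronglySymmetricallyComplete⇒symmetricallyDComplete scomplete))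
  , extremely⇔
  where
  open OrderTheory em ext
  open DiscretelyOrdered em ext G e-least
  a⇒b = symmetricallyDComplete⇒sphericallyComplete (totalOrder G)
  b⇒a = sphericallyComplete⇒symmetricallyDComplete (totalOrder G)
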